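{- Let $G$ be a finite simple graph of maximum degree at most $4$. Then \[ \nu_s(G)\geq \frac{n(G)-i(G)-n_5(G)}{9}, \] where $n(G)$ is the number of vertices of $G$, $i(G)$ is the number of isolated vertices of $G$, and $n_5(G)$ is the number of connected components of $G$ that are isomorphic to $C_5^2$.
   Context: An induced matching of a graph $G$ is a set $M$ of edges of $G$ such that no two edges of $M$ share an endvertex and no edge of $G$ joins an endvertex of one edge of $M$ to an endvertex of another edge of $M$. The strong matching number (induced matching number) $\nu_s(G)$ is the maximum size of an induced matching of $G$. The graph $C_5^2$ is the graph on $10$ vertices obtained from a $5$-cycle $x_1x_2x_3x_4x_5x_1$ by replacing each vertex $x_j$ by an independent set $X_j$ of two vertices, and joining every vertex of $X_j$ to every vertex of $X_{j+1}$ (indices modulo $5$); it is $4$-regular. -}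

module Defs where

open import Data.Nat using (ℕ; zero; suc; _+_; _%_; _≡ᵇ_; _≤_)
open import Data.Fin using (Fin; toℕ)
open import Data.Bool using (Bool; true; false; _∨_)
open import Data.List using (List; length; lookup; filter; allFin)
open import Data.Product using (_×_; _,_; Σ; ∃)
open import Relation.Binary.PropositionalEquality using (_≡_; _≢_)
open import Relation.Nullary.Decidable using (does)
open import Data.Nat.Properties using (_≟_)
open import Data.Bool.Properties using (T?)
open import Function.Definitions using (Injective)

record Graph (n : ℕ) : Set where
  field
    adj   : Fin n → Fin n → Bool
    sym   : ∀ u v → adj u v ≡ adj v u
    irrefl : ∀ v → adj v v ≡ false
open Graph public

degree : ∀ {n} → Graph n → Fin n → ℕ
degree {n} G v = length (filter (λ u → T? (adj G v u)) (allFin n))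

MaxDegreeAtMost : ∀ {n} → Graph n → ℕ → Set
MaxDegreeAtMost G d = ∀ v → degree G v ≤ d

isolatedCount : ∀ {n} → Graph n → ℕ
isolatedCount {n} G = length (filter (λ v → degree G v ≟ 0) (allFin n))

Separated : ∀ {n} → Graph n → (Fin n × Fin n) → (Fin n × Fin n) → Set
Separated G (a , b) (c , d) =
  (a ≢ c × a ≢ d × b ≢ c × b ≢ d) ×
  (adj G a c ≡ false × adj G a d ≡ false × adj G b c ≡ false × adj G b d ≡ false)

IsInducedMatching : ∀ {n} → Graph n → List (Fin n × Fin n) → Set
IsInducedMatching G M =
  (∀ i → let (x , y) = lookup M i in adj G x y ≡ true) ×
  (∀ i j → i ≢ j → Separated G (lookup M i) (lookup M j))

data Reachable {n} (G : Graph n) : Fin n → Fin n → Set where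
  here : ∀ {v} → Reachable G v v
  step : ∀ {u v w} → adj G u v ≡ true → Reachable G v w → Reachable G u w

-- The graph C_5^2 on Fin 10: vertex a lies in class X_(a mod 5);
-- a ~ b iff their classes are consecutive on the 5-cycle.
cls : Fin 10 → ℕ
cls a = toℕ a % 5

c52adj : Fin 10 → Fin 10 → Bool
c52adj a b = (((cls a + 1) % 5) ≡ᵇ cls b) ∨ (((cls b + 1) % 5) ≡ᵇ cls a)

ComponentIsC52 : ∀ {n} → Graph n → Fin n → Set
ComponentIsC52 {n} G v =
  Σ (Fin 10 → Fin n) λ f →
    Injective _≡_ _≡_ f ×
    (∀ a b → adj G (f a) (f b) ≡ c52adj a b) ×
    (∀ a → Reachable G v (f a)) ×
    (∀ u → Reachable G v u → ∃ λ a → f a ≡ u)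

-- A list of representatives, one for each component isomorphic to C_5^2
-- (exactly one per such component); its length is n_5(G).
IsC52ComponentReps : ∀ {n} → Graph n → List (Fin n) → Set
IsC52ComponentReps G R =
  (∀ i → ComponentIsC52 G (lookup R i)) ×
  (∀ i j → i ≢ j → ¬R (lookup R i) (lookup R j)) ×
  (∀ v → ComponentIsC52 G v → ∃ λ i → Reachable G (lookup R i) v)
  where
    open import Relation.Nullary using (¬_)
    ¬R : _ → _ → Set
    ¬R x y = ¬ Reachable G x y

{-# OPTIONS --safe #-}
-- Choosing an edge uv and deleting N[u] ∪ N[v] costs the vertices near uv and those that
-- become isolated (stranded). If this cost is at most 9 for some edge, choose it and
-- continue; an induced C_5^2 is a whole component, contributes one edge, and costs 10.
-- So it suffices that a graph with an edge, of maximum degree at most 4, in which every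
-- edge costs at least 10, contains an induced C_5^2. Start at a vertex of minimum positive
-- degree δ and explore its surroundings: an edge uv whose neighbourhood is known and too
-- cheap so far forces a further stranded vertex, all of whose neighbours are near uv. This
-- is so restrictive that a search over partially known graphs is finite for each
-- δ = 1, 2, 3, 4. It is carried out by a verified checker following a certificate.

module Submission where

open import Defs
open import Data.Bool using (Bool; true; false; _∧_; _∨_; not; if_then_else_; T)
open import Data.Bool.ListAction using (all; any)
open import Data.Bool.Properties using (T?) renaming (_≟_ to _≟B_)
open import Data.Char using () renaming (toℕ to code)
open import Data.Empty using (⊥; ⊥-elim)
open import Data.Fin using (Fin; toℕ) renaming (zero to fz; suc to fs)
open import Data.Fin.Properties using (toℕ-injective) renaming (_≟_ to _≟F_; all? to allF?; any? to anyF?)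
open import Data.List using (List; []; _∷_; _++_; map; mapMaybe; concatMap; zipWith; length; lookup; replicate; splitAt; filter; filterᵇ; tabulate; allFin)
open import Data.List.Membership.Propositional using (_∈_; _∉_; find; lose)
open import Data.List.Membership.Propositional.Properties using (∈-filter⁺; ∈-filter⁻; ∈-allFin; ∈-∃++; ∈-map⁺; ∈-map⁻; ∈-++⁺ˡ; ∈-++⁺ʳ; ∈-++⁻; ∈-lookup)
open import Data.List.Properties using (length-++; length-map; length-tabulate; map-tabulate; filter-none)
open import Data.List.Relation.Binary.Pointwise as Pointwise using (Pointwise; []; _∷_)
open import Data.List.Relation.Unary.All as All using (All; []; _∷_)
open import Data.List.Relation.Unary.AllPairs using (AllPairs; []; _∷_)
open import Data.List.Relation.Unary.Any as Any using (Any; here; there)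
import Data.List.Relation.Unary.Any.Properties as Anyₚ
open import Data.List.Relation.Unary.Unique.Propositional using (Unique)
import Data.List.Relation.Unary.Unique.Propositional.Properties as Uniqueₚ
open import Data.Maybe using (Maybe; just; nothing; _>>=_)
open import Data.Maybe.Properties using (just-injective)
open import Data.Nat using (ℕ; zero; suc; _+_; _*_; _∸_; _≤_; z≤n; s≤s; _≡ᵇ_; _<ᵇ_; _≤ᵇ_; _≤?_)
open import Data.Nat.Properties as ℕₚ using (≤-trans; ≤-refl; ≤-reflexive; m≤n⇒m≤1+n; <⇒≱; ≤ᵇ⇒≤; <ᵇ⇒<; ≡ᵇ⇒≡; ≡⇒≡ᵇ; +-suc; ≰⇒>)
open import Data.Product using (_×_; _,_; proj₁; proj₂; map₂; ∃; ∃₂)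
open import Data.String using (String; toList)
open import Data.Sum using (_⊎_; inj₁; inj₂)
open import Data.Unit using (⊤; tt)
open import Function using (_∘_; id)
open import Function.Definitions using (Injective)
open import Relation.Binary.PropositionalEquality using (_≡_; _≢_; refl; cong; cong₂; subst; trans) renaming (sym to ≡-sym)
open import Relation.Nullary using (Dec; yes; no; contradiction; ¬?; does)
open import Relation.Nullary.Decidable using (_×-dec_; _⊎-dec_; from-yes; dec-true)

-- The two ends of an edge see at most 8 vertices, themselves included, so a cost of 10 means at
-- least two stranded vertices. In `C_5^2` every edge sees exactly 8 and strands the two vertices of
-- the opposite class: its cost is exactly 10, which is why it must be excepted. Stranded vertices
-- are the right objects to branch on. Once both ends of an edge are fully explored, every possible
-- neighbour of a stranded vertex has a name; such a vertex therefore enters a state already closed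
-- and is never itself explored outward. Contradictions come from two sides: more than four
-- neighbours, or a closed vertex left with fewer than `δ` possible ones. Only soundness of the
-- checker is proved. The tokens merely select rules, and a bad choice can make the check fail but
-- cannot make it accept wrongly.

-- Partially known graphs and their normal form

data Status : Set where
  joined apart unknown : Status

isJoined isApart isUnknown : Status → Bool
isJoined joined = true
isJoined apart  = false
isJoined unknown = false
isApart joined = false
isApart apart  = true
isApart unknown = false
isUnknown joined = false
isUnknown apart  = false
isUnknown unknown = true

Row : Set
Row = List Status

-- A partially known graph on named vertices 0, 1, …: the row of a vertex gives its
-- relation to every named vertex, and the flag says that it has no unnamed neighbours.
State : Set
State = List (Bool × Row)

count : {A : Set} → (A → Bool) → List A → ℕ
count p xs = length (filterᵇ p xs)

nth : {A : Set} → List A → ℕ → Maybe A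
nth []       _       = nothing
nth (x ∷ xs) zero    = just x
nth (x ∷ xs) (suc i) = nth xs i

updateAt : {A : Set} → ℕ → (A → A) → List A → List A
updateAt _       f []       = []
updateAt zero    f (x ∷ xs) = f x ∷ xs
updateAt (suc i) f (x ∷ xs) = x ∷ updateAt i f xs

settle : Status → Status
settle unknown = apart
settle s   = s

combine : Status → Status → Status
combine unknown t = t
combine s   _ = s

saturate : Bool × Row → Bool × Row
saturate (c , r) = if 4 ≤ᵇ count isJoined r then (true , map settle r) else (c , r)

transpose : ℕ → List Row → List Row
transpose k []       = replicate k []
transpose k (r ∷ rs) = zipWith _∷_ r (transpose k rs)

symmetrise : State → State
symmetrise S = zipWith (λ v col → map₂ (λ r → zipWith combine r col) v) S
                       (transpose (length S) (map proj₂ S))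

-- Only the row of the changed vertex has to be right: normalise copies the information
-- to the columns, and uses that a vertex with four known neighbours has no others.
normalise : State → State
normalise S = symmetrise (map saturate S)

absurdVertex : ℕ → Bool × Row → Bool
absurdVertex δ (c , r) = (4 <ᵇ count isJoined r) ∨ (c ∧ (count (λ s → not (isApart s)) r <ᵇ δ))

-- Branching rules

set : ℕ → ℕ → Status → State → State
set x y s S = updateAt y (map₂ (updateAt x (λ _ → s))) (updateAt x (map₂ (updateAt y (λ _ → s))) S)

split : ℕ → ℕ → State → List State
split x y S = set x y joined S ∷ set x y apart S ∷ []

addVertex : Bool → Row → State → State
addVertex c r S = zipWith (λ v s → map₂ (_++ s ∷ []) v) S r ++ (c , r ++ apart ∷ []) ∷ []

close : ℕ → State → State
close x = updateAt x (λ v → true , proj₂ v)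

extend : ℕ → State → List State
extend x S = close x S
           -- A closed vertex has no unnamed neighbours, so it is `apart` from the new vertex at
           -- once.
           ∷ addVertex false (updateAt x (λ _ → joined) (map (λ v → if proj₁ v then apart else unknown) S)) S
           ∷ []

indices : List Bool → List ℕ
indices []           = []
indices (true  ∷ bs) = 0 ∷ map suc (indices bs)
indices (false ∷ bs) = map suc (indices bs)

decided : Bool × Row → Bool
decided (c , r) = c ∧ all (λ s → not (isUnknown s)) r

_or_ : Row → Row → List Bool
_or_ = zipWith (λ s t → isJoined s ∨ isJoined t)

fits surely : List Bool → Row → Bool
fits   N r = all (λ b → b) (zipWith (λ b s → b ∨ not (isJoined s)) N r)
surely N r = all (λ b → b) (zipWith (λ b s → b ∨ isApart s) N r)

-- N marks the closed neighbourhood of the edge. A found vertex certainly loses all its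
-- neighbours when N is removed, and a candidate may or may not.
isFound isCandidate : List Bool → Bool → Bool × Row → Bool
isFound     N b (c , r) = not b ∧ (c ∧ surely N r)
isCandidate N b (c , r) = not b ∧ (fits N r ∧ not (c ∧ surely N r))

found candidates : List Bool → State → List Bool
found      N S = zipWith (isFound N) N S
candidates N S = zipWith (isCandidate N) N S

confine : List Bool → Row → Row
confine N r = zipWith (λ b s → if b then s else apart) N r

isolate : List Bool → ℕ → State → State
isolate N i = updateAt i (λ v → true , confine N (proj₂ v))

-- A missing stranded vertex is either a named vertex that may still turn out stranded or a new one.
-- It is closed in both cases, because its neighbours lie in `N` and so have names; a new one can be
-- joined only to members of `N` that are not closed.
witnesses : List Bool → State → List State
witnesses N S =
  map (λ i → isolate N i S) (indices (candidates N S)) ++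
  addVertex true (zipWith (λ b v → if b ∧ not (proj₁ v) then unknown else apart) N S) S ∷ []

isEdge : Maybe Status → Bool
isEdge (just s) = isJoined s
isEdge nothing  = false

-- Ten is the cost that `crowded` guarantees: below it, some stranded vertex is missing from
-- `found`.
scarce : List Bool → State → Bool
scarce N S = count (λ b → b) N + count (λ b → b) (found N S) <ᵇ 10

-- Both rows have to be decided, since an unknown or unnamed neighbour of `u` or `v` would make `N`
-- incomplete and the cost underestimated.
witness : ℕ → ℕ → State → Maybe (List State)
witness u v S with nth S u | nth S v
... | just p | just q =
  if (decided p ∧ decided q) ∧ (isEdge (nth (proj₂ p) v) ∧ scarce (proj₂ p or proj₂ q) S)
  then just (witnesses (proj₂ p or proj₂ q) S) else nothing
... | _ | _ = nothing

-- Embeddings of states and the checker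

member : ℕ → List ℕ → Bool
member i = any (i ≡ᵇ_)

distinct : List ℕ → Bool
distinct []       = true
distinct (i ∷ is) = not (member i is) ∧ distinct is

pick : {A : Set} → List A → List ℕ → List A
pick xs = mapMaybe (nth xs)

outside : ℕ → List ℕ → Row → Bool
outside i p []      = true
outside i p (s ∷ r) = (member i p ∨ isApart s) ∧ outside (suc i) p r

-- A closed vertex stays closed only if every forgotten vertex is known to be `apart` from it.
restrict : State → List ℕ → State
restrict S p = map (λ v → (proj₁ v ∧ outside 0 p (proj₂ v)) , pick (proj₂ v) p) (pick S p)

leStatus : Status → Status → Bool
leStatus unknown _   = true
leStatus joined t   = isJoined t
leStatus apart  t   = isApart t

pointwise : {A B : Set} → (A → B → Bool) → List A → List B → Bool
pointwise p []       []       = true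
pointwise p (x ∷ xs) (y ∷ ys) = p x y ∧ pointwise p xs ys
pointwise p _        _        = false

leVertex : Bool × Row → Bool × Row → Bool
leVertex (c , r) (d , s) = (not c ∨ d) ∧ pointwise leStatus r s

-- Entailment rather than isomorphism: `L` may have fewer vertices and know less than `S`. A
-- realization of `S`, cut down to `p`, then realizes `L`, so a refuted `L` refutes `S`.
embeds : State → State → List ℕ → Bool
embeds L S p = distinct p ∧ pointwise leVertex L (restrict S p)

embedding : List State → State → List ℕ → Maybe (List ℕ)
embedding ctx S []       = nothing
embedding ctx S (j ∷ ts) with nth ctx j
... | nothing = nothing
... | just L with splitAt (length L) ts
...   | (p , ts′) = if embeds L S p then just ts′ else nothing

-- The numbers 0 to 3 select a rule; rule 3 closes a state containing the image of a state
-- in the context, where checkNext has put the already refuted elder siblings of its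
-- ancestors. This replaces every appeal to symmetry.
check     : ℕ → ℕ → List State → State → List ℕ → Maybe (List ℕ)
checkAll  : ℕ → ℕ → List State → List State → List ℕ → Maybe (List ℕ)
checkNext : ℕ → ℕ → List State → State → List State → List ℕ → Maybe (List ℕ)

check δ zero    ctx S ts = nothing
check δ (suc f) ctx S (0 ∷ x ∷ y ∷ ts) = checkAll δ f ctx (split x y S) ts
check δ (suc f) ctx S (1 ∷ x ∷ ts)     = checkAll δ f ctx (extend x S) ts
check δ (suc f) ctx S (2 ∷ u ∷ v ∷ ts) = witness u v S >>= λ Ss → checkAll δ f ctx Ss ts
check δ (suc f) ctx S (3 ∷ ts)         = embedding ctx S ts
check δ (suc f) ctx S _                = nothing

checkAll δ f ctx []       ts = just ts
checkAll δ f ctx (S ∷ Ss) ts = checkNext δ f ctx (normalise S) Ss ts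

checkNext δ f ctx S Ss ts =
  if any (absurdVertex δ) S then checkAll δ f ctx Ss ts
  else (check δ f ctx S ts >>= checkAll δ f (S ∷ ctx) Ss)

-- Initial states

free : ℕ → State
free zero    = []
free (suc k) = (false , apart ∷ replicate k unknown) ∷ map (map₂ (unknown ∷_)) (free k)

-- A vertex with exactly δ neighbours, the relations between these being unknown.
star : ℕ → State
star δ = (true , apart ∷ replicate δ joined) ∷ map (map₂ (joined ∷_)) (free δ)

-- No vertex is marked closed: the adjacencies among the ten vertices are enough to exhibit a copy,
-- and that a copy has no outside neighbours follows separately from the degree bound.
blownUpC5 : State
blownUpC5 = map (λ a → false , map (λ b → if c52adj a b then joined else apart) (allFin 10)) (allFin 10)

-- The certificates were found by a computer search; a character stands for its code minus
-- 48. The initial context holds C_5^2 itself, so a branch may also end by exhibiting it.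
tokens : List String → List ℕ
tokens = concatMap (λ s → map (λ c → code c ∸ 48) (toList s))

-- The certificate lists the search tree in preorder, each subtree handing its unread tokens on to
-- the next. The number 400 bounds only the depth of the tree, since siblings share it.
run : ℕ → List String → Maybe (List ℕ)
run δ s = checkAll δ 400 (blownUpC5 ∷ []) (star δ ∷ []) (tokens s)

-- Booleans, lists and counting

∧-true : ∀ {a b} → a ∧ b ≡ true → a ≡ true × b ≡ true
∧-true {true} {true} _ = refl , refl

∨-true : ∀ {a b} → a ∨ b ≡ true → a ≡ true ⊎ b ≡ true
∨-true {true}  _ = inj₁ refl
∨-true {false} p = inj₂ p

∨-trueˡ : ∀ {a} b → a ≡ true → a ∨ b ≡ true
∨-trueˡ b refl = refl

∨-trueʳ : ∀ a {b} → b ≡ true → a ∨ b ≡ true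
∨-trueʳ true  refl = refl
∨-trueʳ false refl = refl

T⇒≡ : ∀ {b} → T b → b ≡ true
T⇒≡ {true} _ = refl

≡⇒T : ∀ {b} → b ≡ true → T b
≡⇒T refl = tt

not-true : ∀ {b} → b ≢ true → b ≡ false
not-true {false} _ = refl
not-true {true}  q = contradiction refl q

clash : ∀ {ℓ} {X : Set ℓ} {b} → b ≡ true → b ≡ false → X
clash refl ()

module _ {A : Set} where

  ∈-filterᵇ⁺ : ∀ (p : A → Bool) {x xs} → x ∈ xs → p x ≡ true → x ∈ filterᵇ p xs
  ∈-filterᵇ⁺ p x∈ px = ∈-filter⁺ (T? ∘ p) x∈ (≡⇒T px)

  ∈-filterᵇ⁻ : ∀ (p : A → Bool) {x xs} → x ∈ filterᵇ p xs → x ∈ xs × p x ≡ true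
  ∈-filterᵇ⁻ p {xs = xs} x∈ = map₂ T⇒≡ (∈-filter⁻ (T? ∘ p) {xs = xs} x∈)

  -- The pigeonhole principle: the elements of `xs` are cut out of `ys` one at a time, and
  -- uniqueness keeps the later ones in what is left.
  unique-⊆⇒length≤ : ∀ {xs ys : List A} → Unique xs → (∀ {z} → z ∈ xs → z ∈ ys) → length xs ≤ length ys
  unique-⊆⇒length≤ {[]}     _          _ = z≤n
  unique-⊆⇒length≤ {x ∷ xs} (x∉ ∷ uxs) xs⊆ys with ∈-∃++ (xs⊆ys (here refl))
  ... | as , bs , refl =
    ≤-trans (s≤s (unique-⊆⇒length≤ uxs keep))
            (≤-reflexive (trans (cong suc (length-++ as))
                         (≡-sym (trans (length-++ as) (+-suc (length as) (length bs))))))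
    where
    keep : ∀ {z} → z ∈ xs → z ∈ as ++ bs
    keep z∈ with ∈-++⁻ as (xs⊆ys (there z∈))
    ... | inj₁ q           = ∈-++⁺ˡ q
    ... | inj₂ (here refl) = contradiction refl (All.lookup x∉ z∈)
    ... | inj₂ (there q)   = ∈-++⁺ʳ as q

  nth⇒∈ : ∀ {xs : List A} {i x} → nth xs i ≡ just x → x ∈ xs
  nth⇒∈ {x ∷ xs} {zero}  refl = here refl
  nth⇒∈ {x ∷ xs} {suc i} eq   = there (nth⇒∈ {xs} {i} eq)

  ∈⇒nth : ∀ {xs : List A} {x} → x ∈ xs → ∃ λ i → nth xs i ≡ just x
  ∈⇒nth (here refl) = 0 , refl
  ∈⇒nth (there x∈) with ∈⇒nth x∈
  ... | i , eq = suc i , eq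

  nth-unique : ∀ {xs : List A} {x} i j → Unique xs → nth xs i ≡ just x → nth xs j ≡ just x → i ≡ j
  nth-unique {_ ∷ _}  zero    zero    _        _    _    = refl
  nth-unique {_ ∷ xs} zero    (suc j) (x∉ ∷ _) refl eq   = contradiction refl (All.lookup x∉ (nth⇒∈ {xs} {j} eq))
  nth-unique {_ ∷ xs} (suc i) zero    (x∉ ∷ _) eq   refl = contradiction refl (All.lookup x∉ (nth⇒∈ {xs} {i} eq))
  nth-unique {_ ∷ _}  (suc i) (suc j) (_ ∷ u)  eq   eq′  = cong suc (nth-unique i j u eq eq′)

  nth-tabulate : ∀ {k} (f : Fin k → A) a → nth (tabulate f) (toℕ a) ≡ just (f a)
  nth-tabulate f fz     = refl
  nth-tabulate f (fs a) = nth-tabulate (f ∘ fs) a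

nth-map-allFin : ∀ {A : Set} {k} (f : Fin k → A) a → nth (map f (allFin k)) (toℕ a) ≡ just (f a)
nth-map-allFin f a rewrite map-tabulate id f = nth-tabulate f a

module _ {A B : Set} {R : A → B → Set} where

  nth⁺ : ∀ {xs ys} i {x} → Pointwise R xs ys → nth xs i ≡ just x → ∃ λ y → nth ys i ≡ just y × R x y
  nth⁺ zero    (r ∷ rs) refl = _ , refl , r
  nth⁺ (suc i) (r ∷ rs) eq   = nth⁺ i rs eq

  nth⁻ : ∀ {xs ys} i {y} → Pointwise R xs ys → nth ys i ≡ just y → ∃ λ x → nth xs i ≡ just x × R x y
  nth⁻ zero    (r ∷ rs) refl = _ , refl , r
  nth⁻ (suc i) (r ∷ rs) eq   = nth⁻ i rs eq

  updateAt⁺ : ∀ {f xs ys} i → Pointwise R xs ys →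
              (∀ {x y} → nth ys i ≡ just y → R x y → R (f x) y) → Pointwise R (updateAt i f xs) ys
  updateAt⁺ i       []       h = []
  updateAt⁺ zero    (r ∷ rs) h = h refl r ∷ rs
  updateAt⁺ (suc i) (r ∷ rs) h = r ∷ updateAt⁺ i rs h

  -- Related lists have the same length, so an index is out of range in both or in neither, and
  -- `pick` skips the same entries.
  pick⁺ : ∀ {xs ys} → Pointwise R xs ys → ∀ p → Pointwise R (pick xs p) (pick ys p)
  pick⁺ rs [] = []
  pick⁺ {xs} {ys} rs (i ∷ p) with nth xs i in eq | nth ys i in eq′
  ... | nothing | nothing = pick⁺ rs p
  ... | just x  | just y  with nth⁺ i rs eq
  ...   | _ , eq″ , r with just-injective (trans (≡-sym eq″) eq′)
  ...     | refl = r ∷ pick⁺ rs p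
  pick⁺ rs (i ∷ p) | just x | nothing with nth⁺ i rs eq
  ... | _ , eq″ , _ with () ← trans (≡-sym eq″) eq′
  pick⁺ rs (i ∷ p) | nothing | just y with nth⁻ i rs eq′
  ... | _ , eq″ , _ with () ← trans (≡-sym eq″) eq

  mapˡ⁺ : ∀ {C : Set} {Q : C → B → Set} {f : A → C} {xs ys} →
          Pointwise R xs ys → (∀ {x y} → R x y → Q (f x) y) → Pointwise Q (map f xs) ys
  mapˡ⁺ []       h = []
  mapˡ⁺ (r ∷ rs) h = h r ∷ mapˡ⁺ rs h

zipWith⁺ : ∀ {A B C D : Set} {R : A → D → Set} {Q : B → D → Set} {P : C → D → Set} {f : A → B → C} {xs ys zs} →
           Pointwise R xs zs → Pointwise Q ys zs → (∀ {x y z} → R x z → Q y z → P (f x y) z) →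
           Pointwise P (zipWith f xs ys) zs
zipWith⁺ []       []       h = []
zipWith⁺ (r ∷ rs) (q ∷ qs) h = h r q ∷ zipWith⁺ rs qs h

∈-pick : ∀ {A : Set} {xs : List A} p {i x} → member i p ≡ true → nth xs i ≡ just x → x ∈ pick xs p
∈-pick {xs = xs} (j ∷ p) {i} m eq with ∨-true {i ≡ᵇ j} m
... | inj₁ q rewrite ≡-sym (≡ᵇ⇒≡ i j (≡⇒T q)) | eq = here refl
... | inj₂ q with nth xs j
...   | just _  = there (∈-pick {xs = xs} p {i} q eq)
...   | nothing = ∈-pick {xs = xs} p {i} q eq

pick-∈ : ∀ {A : Set} {xs : List A} p {x} → x ∈ pick xs p → ∃ λ i → member i p ≡ true × nth xs i ≡ just x
pick-∈ {xs = xs} (j ∷ p) x∈ with nth xs j in eq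
pick-∈ (j ∷ p) (here refl) | just _ = j , ∨-trueˡ _ (T⇒≡ (≡⇒≡ᵇ j j refl)) , eq
pick-∈ {xs = xs} (j ∷ p) (there x∈) | just _ =
  let i , m , eq′ = pick-∈ {xs = xs} p x∈ in i , ∨-trueʳ (i ≡ᵇ j) m , eq′
pick-∈ {xs = xs} (j ∷ p) x∈ | nothing =
  let i , m , eq′ = pick-∈ {xs = xs} p x∈ in i , ∨-trueʳ (i ≡ᵇ j) m , eq′

pick-unique : ∀ {A : Set} {xs : List A} p → Unique xs → distinct p ≡ true → Unique (pick xs p)
pick-unique []      u d = []
pick-unique {xs = xs} (i ∷ p) u d with ∧-true {not (member i p)} d
... | i∉ , dp with nth xs i in eq
...   | nothing = pick-unique p u dp
...   | just x  = All.tabulate (λ {y} y∈ x≡y → fresh (subst (_∈ pick xs p) (≡-sym x≡y) y∈)) ∷ pick-unique p u dp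
  where
  fresh : x ∉ pick xs p
  fresh x∈ with pick-∈ {xs = xs} p x∈
  ... | j , m , eq′ = clash i∉ (cong not (subst (λ k → member k p ≡ true) (≡-sym (nth-unique i j u eq eq′)) m))

select : ∀ {A : Set} → List Bool → List A → List A
select (true  ∷ bs) (x ∷ xs) = x ∷ select bs xs
select (false ∷ bs) (x ∷ xs) = select bs xs
select _            _        = []

length-select≤ : ∀ {A : Set} bs (xs : List A) → length (select bs xs) ≤ count id bs
length-select≤ []           xs       = z≤n
length-select≤ (true  ∷ bs) []       = z≤n
length-select≤ (true  ∷ bs) (x ∷ xs) = s≤s (length-select≤ bs xs)
length-select≤ (false ∷ bs) []       = z≤n
length-select≤ (false ∷ bs) (x ∷ xs) = length-select≤ bs xs

∈-select : ∀ {A : Set} bs {xs : List A} i {x} → nth xs i ≡ just x → nth bs i ≡ just true → x ∈ select bs xs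
∈-select (true  ∷ bs) {_ ∷ _} zero    refl refl = here refl
∈-select (true  ∷ bs) {_ ∷ _} (suc i) eq   eq′  = there (∈-select bs i eq eq′)
∈-select (false ∷ bs) {_ ∷ _} (suc i) eq   eq′  = ∈-select bs i eq eq′

indices-∈ : ∀ bs i → nth bs i ≡ just true → i ∈ indices bs
indices-∈ (true  ∷ bs) zero    refl = here refl
indices-∈ (true  ∷ bs) (suc i) eq   = there (∈-map⁺ suc (indices-∈ bs i eq))
indices-∈ (false ∷ bs) (suc i) eq   = ∈-map⁺ suc (indices-∈ bs i eq)

nth-zipWith : ∀ {A B C : Set} (f : A → B → C) {xs ys x y} i → nth xs i ≡ just x → nth ys i ≡ just y →
              nth (zipWith f xs ys) i ≡ just (f x y)
nth-zipWith f {_ ∷ _} {_ ∷ _}  zero    refl refl = refl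
nth-zipWith f {_ ∷ xs} {_ ∷ ys} (suc i) eq   eq′  = nth-zipWith f {xs} {ys} i eq eq′

count-cong : ∀ {A : Set} {p : A → Bool} {bs xs} → Pointwise (λ b x → b ≡ p x) bs xs → count id bs ≡ count p xs
count-cong [] = refl
count-cong {p = p} {xs = x ∷ _} (refl ∷ es) with p x
... | true  = cong suc (count-cong es)
... | false = count-cong es

-- Induced copies of C_5^2 and the cost of an edge

IsC52 : ∀ {n} → Graph n → (Fin 10 → Fin n) → Set
IsC52 G f = Injective _≡_ _≡_ f × (∀ a b → adj G (f a) (f b) ≡ c52adj a b)

HasC52 : ∀ {n} → Graph n → Set
HasC52 G = ∃ (IsC52 G)

module _ {n} (G : Graph n) where

  -- For adjacent `u` and `v` this is already the union of the closed neighbourhoods, each end being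
  -- a neighbour of the other.
  near : Fin n → Fin n → Fin n → Bool
  near u v z = adj G u z ∨ adj G v z

  active : Fin n → Bool
  active w = any (adj G w) (allFin n)

  -- Requiring `active` leaves out the vertices that were isolated beforehand; those are paid for by
  -- i(G).
  stranded : Fin n → Fin n → Fin n → Bool
  stranded u v w = active w ∧ (not (near u v w) ∧ all (λ z → not (adj G w z) ∨ near u v z) (allFin n))

any⁺ : ∀ {A : Set} (p : A → Bool) {x xs} → x ∈ xs → p x ≡ true → any p xs ≡ true
any⁺ p (here refl) px = ∨-trueˡ _ px
any⁺ p (there x∈)  px = ∨-trueʳ (p _) (any⁺ p x∈ px)

any⁻ : ∀ {A : Set} (p : A → Bool) xs → any p xs ≡ true → ∃ λ x → x ∈ xs × p x ≡ true
any⁻ p (x ∷ xs) eq with ∨-true {p x} eq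
... | inj₁ q = x , here refl , q
... | inj₂ q with any⁻ p xs q
...   | y , y∈ , py = y , there y∈ , py

all⁻ : ∀ {A : Set} (p : A → Bool) {x xs} → all p xs ≡ true → x ∈ xs → p x ≡ true
all⁻ p eq (here refl) = proj₁ (∧-true eq)
all⁻ p {xs = y ∷ ys} eq (there x∈)  = all⁻ p (proj₂ (∧-true {p y} eq)) x∈

-- crowded says that no edge can be chosen greedily at cost 9, as in a minimal counterexample.
module Soundness {n} (G : Graph n) (δ : ℕ)
  (Δ≤4 : MaxDegreeAtMost G 4)
  (δ≤deg : ∀ x → active G x ≡ true → δ ≤ degree G x)
  (crowded : ∀ u v → adj G u v ≡ true → 10 ≤ count (near G u v) (allFin n) + count (stranded G u v) (allFin n))
  where

  -- Realizations of states

  V : Set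
  V = Fin n

  Holds : Status → V → V → Set
  Holds joined x y = adj G x y ≡ true
  Holds apart  x y = adj G x y ≡ false
  Holds unknown x y = ⊤

  Holds-sym : ∀ s {x y} → Holds s x y → Holds s y x
  Holds-sym joined {x} {y} h = trans (sym G y x) h
  Holds-sym apart  {x} {y} h = trans (sym G y x) h
  Holds-sym unknown h = tt

  RowOK : List V → Row → V → Set
  RowOK ρ r x = Pointwise (λ s y → Holds s x y) r ρ

  ClosedIn : List V → V → Set
  ClosedIn ρ x = ∀ z → adj G x z ≡ true → z ∈ ρ

  -- Activity belongs to the invariant because `δ≤deg` speaks of active vertices only; it is what
  -- makes a closed vertex with fewer than `δ` possible neighbours absurd.
  VertexOK : List V → Bool × Row → V → Set
  VertexOK ρ (c , r) x = active G x ≡ true × (c ≡ true → ClosedIn ρ x) × RowOK ρ r x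

  Realizes : State → List V → Set
  Realizes S ρ = Unique ρ × Pointwise (VertexOK ρ) S ρ

  Realizable : State → Set
  Realizable S = ∃ λ ρ → Realizes S ρ

  -- Refutation is taken modulo the desired conclusion. Contradictory states and states that display
  -- a `C_5^2` are thus handled alike, and `blownUpC5` itself counts as refuted.
  Refuted : State → Set
  Refuted S = Realizable S → HasC52 G

  few-neighbours : ∀ {x ys} → Unique ys → (∀ {y} → y ∈ ys → adj G x y ≡ true) → length ys ≤ 4
  few-neighbours {x} u h =
    ≤-trans (unique-⊆⇒length≤ u (λ y∈ → ∈-filterᵇ⁺ (adj G x) (∈-allFin _) (h y∈))) (Δ≤4 x)

  named-degree≤4 : ∀ {ρ} x → Unique ρ → count (adj G x) ρ ≤ 4
  named-degree≤4 {ρ} x u = few-neighbours (Uniqueₚ.filter⁺ (T? ∘ adj G x) u) (λ y∈ → proj₂ (∈-filterᵇ⁻ (adj G x) {xs = ρ} y∈))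

  count-yes≤ : ∀ {r ρ x} → RowOK ρ r x → count isJoined r ≤ count (adj G x) ρ
  count-yes≤ [] = z≤n
  count-yes≤ {joined ∷ r} (h ∷ hs) rewrite h = s≤s (count-yes≤ hs)
  count-yes≤ {apart ∷ r} (h ∷ hs) rewrite h = count-yes≤ hs
  count-yes≤ {unknown ∷ r} {y ∷ ρ} {x} (h ∷ hs) with adj G x y
  ... | true  = m≤n⇒m≤1+n (count-yes≤ hs)
  ... | false = count-yes≤ hs

  count≤-possible : ∀ {r ρ x} → RowOK ρ r x → count (adj G x) ρ ≤ count (λ s → not (isApart s)) r
  count≤-possible [] = z≤n
  count≤-possible {joined ∷ r} (h ∷ hs) rewrite h = s≤s (count≤-possible hs)
  count≤-possible {apart ∷ r} (h ∷ hs) rewrite h = count≤-possible hs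
  count≤-possible {unknown ∷ r} {y ∷ ρ} {x} (h ∷ hs) with adj G x y
  ... | true  = s≤s (count≤-possible hs)
  ... | false = m≤n⇒m≤1+n (count≤-possible hs)

  -- When the entries `joined` already account for all named neighbours, an adjacency behind an
  -- `unknown` would be one neighbour too many.
  settle-row : ∀ {r ρ x} → RowOK ρ r x → count (adj G x) ρ ≤ count isJoined r → RowOK ρ (map settle r) x
  settle-row [] le = []
  settle-row {joined ∷ r} (h ∷ hs) le rewrite h = h ∷ settle-row hs (ℕₚ.≤-pred le)
  settle-row {apart ∷ r} (h ∷ hs) le rewrite h = h ∷ settle-row hs le
  settle-row {unknown ∷ r} {y ∷ ρ} {x} (h ∷ hs) le with adj G x y in eq
  ... | true  = contradiction (count-yes≤ hs) (<⇒≱ le)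
  ... | false = eq ∷ settle-row hs le

  saturate-sound : ∀ {ρ v x} → Unique ρ → VertexOK ρ v x → VertexOK ρ (saturate v) x
  saturate-sound {ρ} {c , r} {x} u ok@(act , cl , row) with 4 ≤ᵇ count isJoined r in eq
  ... | false = ok
  ... | true  = act , (λ _ → closed) , settle-row row (≤-trans (named-degree≤4 x u) four)
    where
    four : 4 ≤ count isJoined r
    four = ≤ᵇ⇒≤ 4 _ (≡⇒T eq)
    closed : ClosedIn ρ x
    closed z xz with Any.any? (z ≟F_) ρ
    ... | yes z∈ = z∈
    -- An unnamed neighbour `z` would be a fifth one, next to the four or more named neighbours.
    ... | no  z∉ = contradiction (≤-trans four (count-yes≤ row)) (<⇒≱ (few-neighbours
            {ys = z ∷ filterᵇ (adj G x) ρ}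
            (All.tabulate (λ y∈ z≡y → z∉ (subst (_∈ ρ) (≡-sym z≡y) (proj₁ (∈-filterᵇ⁻ (adj G x) {xs = ρ} y∈))))
              ∷ Uniqueₚ.filter⁺ (T? ∘ adj G x) u)
            λ { (here refl) → xz ; (there y∈) → proj₂ (∈-filterᵇ⁻ (adj G x) {xs = ρ} y∈) }))

  -- Rows and columns are indexed by separate lists, so that the induction can remove a row and keep
  -- all columns.
  transpose-sound : ∀ {M : List Row} {ρ ρ′} → Pointwise (λ r x → RowOK ρ r x) M ρ′ →
                    Pointwise (λ col y → RowOK ρ′ col y) (transpose (length ρ) M) ρ
  transpose-sound {ρ = ρ} [] = empty ρ
    where
    empty : ∀ ys → Pointwise (λ col y → RowOK [] col y) (replicate (length ys) []) ys
    empty []       = []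
    empty (y ∷ ys) = [] ∷ empty ys
  transpose-sound (row ∷ rows) = zipWith⁺ row (transpose-sound rows) (λ {s} h col → Holds-sym s h ∷ col)

  combine-sound : ∀ s t {x y} → Holds s x y → Holds t x y → Holds (combine s t) x y
  combine-sound joined t h h′ = h
  combine-sound apart  t h h′ = h
  combine-sound unknown t h h′ = h′

  symmetrise-sound : ∀ {S ρ} → Realizes S ρ → Realizes (symmetrise S) ρ
  symmetrise-sound {S} {ρ} (u , oks) = u , zipWith⁺ oks cols
    (λ { (act , cl , row) col → act , cl , zipWith⁺ row col (λ {s} {t} → combine-sound s t) })
    where
    cols : Pointwise (λ col y → RowOK ρ col y) (transpose (length S) (map proj₂ S)) ρ
    cols rewrite Pointwise.Pointwise-length oks = transpose-sound (mapˡ⁺ oks (proj₂ ∘ proj₂))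

  normalise-sound : ∀ {S ρ} → Realizes S ρ → Realizes (normalise S) ρ
  normalise-sound (u , oks) = symmetrise-sound (u , mapˡ⁺ oks (saturate-sound u))

  absurd-sound : ∀ {S ρ} → Realizes S ρ → any (absurdVertex δ) S ≡ true → ⊥
  absurd-sound {S} {ρ} (u , oks) eq with any⁻ (absurdVertex δ) S eq
  ... | v@(c , r) , v∈ , bad with ∈⇒nth v∈
  ...   | i , eqi with nth⁺ i oks eqi
  ...     | x , _ , act , cl , row with ∨-true {4 <ᵇ count isJoined r} bad
  ...       | inj₁ q = <⇒≱ (<ᵇ⇒< 4 _ (≡⇒T q)) (≤-trans (count-yes≤ row) (named-degree≤4 x u))
  ...       | inj₂ q with ∧-true {c} q
  ...         | ceq , lt = <⇒≱ (<ᵇ⇒< _ δ (≡⇒T lt)) (≤-trans (δ≤deg x act) (≤-trans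
                (unique-⊆⇒length≤ (Uniqueₚ.filter⁺ (T? ∘ adj G x) (Uniqueₚ.allFin⁺ n))
                  (λ y∈ → let xy = proj₂ (∈-filterᵇ⁻ (adj G x) {xs = allFin n} y∈) in ∈-filterᵇ⁺ (adj G x) (cl ceq _ xy) xy))
                (count≤-possible row)))

  -- Soundness of splitting and extending

  update-row : ∀ {ρ v x f i} → VertexOK ρ v x → (∀ {s y} → nth ρ i ≡ just y → Holds s x y → Holds (f s) x y) →
               VertexOK ρ (map₂ (updateAt i f) v) x
  update-row {i = i} (act , cl , row) h = act , cl , updateAt⁺ i row h

  -- The hypothesis concerns only indices that name vertices. For an index out of range it is
  -- vacuous, so `split` needs no range check.
  set-sound : ∀ {S ρ} x y s → Realizes S ρ →
              (∀ {a b} → nth ρ x ≡ just a → nth ρ y ≡ just b → Holds s a b) → Realizes (set x y s S) ρ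
  set-sound x y s (u , oks) h =
    u , updateAt⁺ y (updateAt⁺ x oks (λ eqa ok → update-row {i = y} ok (λ eqb _ → h eqa eqb)))
          (λ eqb ok → update-row {i = x} ok (λ eqa _ → Holds-sym s (h eqa eqb)))

  split-sound : ∀ {S} x y → Realizable S → Any Realizable (split x y S)
  split-sound {S} x y (ρ , real) with nth ρ x in eqa | nth ρ y in eqb
  ... | nothing | _       = here (ρ , set-sound x y joined real λ e _ → contradiction (trans (≡-sym eqa) e) λ ())
  ... | just _  | nothing = here (ρ , set-sound x y joined real λ _ e → contradiction (trans (≡-sym eqb) e) λ ())
  ... | just a  | just b with adj G a b in eq
  ...   | true  = here (ρ , set-sound x y joined real λ e e′ →
            trans (≡-sym (cong₂ (adj G) (just-injective (trans (≡-sym eqa) e)) (just-injective (trans (≡-sym eqb) e′)))) eq)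
  ...   | false = there (here (ρ , set-sound x y apart real λ e e′ →
            trans (≡-sym (cong₂ (adj G) (just-injective (trans (≡-sym eqa) e)) (just-injective (trans (≡-sym eqb) e′)))) eq))

  addVertex-sound : ∀ {S ρ c r z} → Realizes S ρ → z ∉ ρ → active G z ≡ true →
                    (c ≡ true → ClosedIn ρ z) → RowOK ρ r z → Realizes (addVertex c r S) (ρ ++ z ∷ [])
  addVertex-sound {S} {ρ} {c} {r} {z} (u , oks) z∉ act cl row =
    Uniqueₚ.++⁺ u ([] ∷ []) (λ { (y∈ , here refl) → z∉ y∈ })
    , Pointwise.++⁺ (zipWith⁺ oks row (λ {_} {s} → old {s = s}))
        ((act , (λ e y zy → ∈-++⁺ˡ (cl e y zy)) , Pointwise.++⁺ row (irrefl G z ∷ [])) ∷ [])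
    where
    old : ∀ {v s x} → VertexOK ρ v x → Holds s z x → VertexOK (ρ ++ z ∷ []) (map₂ (_++ s ∷ []) v) x
    old {s = s} (act , cl , row) h = act , (λ e y xy → ∈-++⁺ˡ (cl e y xy)) , Pointwise.++⁺ row (Holds-sym s h ∷ [])

  extend-sound : ∀ {S} x → Realizable S → Any Realizable (extend x S)
  extend-sound {S} x (ρ , real@(u , oks)) with nth ρ x in eqa
  ... | nothing = here (ρ , u , updateAt⁺ x oks (λ e _ → contradiction (trans (≡-sym eqa) e) λ ()))
  ... | just a with Any.any? (λ z → (adj G a z ≟B true) ×-dec ¬? (Any.any? (z ≟F_) ρ)) (allFin n)
  ...   | no none = here (ρ , u , updateAt⁺ x oks closes)
    where
    closed : ClosedIn ρ a
    closed z az with Any.any? (z ≟F_) ρ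
    ... | yes z∈ = z∈
    ... | no  z∉ = contradiction (Any.map (λ { refl → az , z∉ }) (∈-allFin z)) none
    closes : ∀ {v y} → nth ρ x ≡ just y → VertexOK ρ v y → VertexOK ρ (true , proj₂ v) y
    closes e (act , cl , row) with just-injective (trans (≡-sym eqa) e)
    ... | refl = act , (λ _ → closed) , row
  ...   | yes some with Any.satisfied some
  ...     | z , az , z∉ = there (here (ρ ++ z ∷ [] , addVertex-sound real z∉ (any⁺ (adj G z) (∈-allFin a) za) (λ ())
                (updateAt⁺ x (mapˡ⁺ oks fresh) (λ e _ → subst (λ y → Holds joined z y) (just-injective (trans (≡-sym eqa) e)) za))))
    where
    za : adj G z a ≡ true
    za = trans (sym G z a) az
    fresh : ∀ {v y} → VertexOK ρ v y → Holds (if proj₁ v then apart else unknown) z y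
    fresh {true , r} {y} (_ , cl , _) with adj G z y in eq
    ... | false = refl
    ... | true  = contradiction (cl refl z (trans (sym G y z) eq)) z∉
    fresh {false , r} _ = tt

  -- Soundness of branching on a stranded vertex

  decided-sound : ∀ {ρ c r x} → decided (c , r) ≡ true → VertexOK ρ (c , r) x →
                  ClosedIn ρ x × Pointwise (λ s y → isJoined s ≡ adj G x y) r ρ
  decided-sound {c = true} d (_ , cl , row) = cl refl , exact d row
    where
    exact : ∀ {r ρ x} → all (λ s → not (isUnknown s)) r ≡ true → RowOK ρ r x → Pointwise (λ s y → isJoined s ≡ adj G x y) r ρ
    exact d [] = []
    exact {joined ∷ r} d (h ∷ hs) = ≡-sym h ∷ exact d hs
    exact {apart  ∷ r} d (h ∷ hs) = ≡-sym h ∷ exact d hs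

  stranded⁻ : ∀ {a b w} → stranded G a b w ≡ true →
              active G w ≡ true × near G a b w ≡ false × (∀ z → adj G w z ≡ true → near G a b z ≡ true)
  stranded⁻ {a} {b} {w} st with ∧-true {active G w} st
  ... | act , rest with near G a b w | ∧-true {not (near G a b w)} rest
  ...   | false | _ , every = act , refl , λ z wz → implied z wz (all⁻ (λ z → not (adj G w z) ∨ near G a b z) every (∈-allFin z))
    where
    implied : ∀ z → adj G w z ≡ true → not (adj G w z) ∨ near G a b z ≡ true → near G a b z ≡ true
    implied z wz q rewrite wz = q

  module Witness {S ρ} (real : Realizes S ρ) {N : List Bool} {a b : V}
    (exactN : Pointwise (λ m y → m ≡ near G a b y) N ρ)
    (closed-a : ClosedIn ρ a) (closed-b : ClosedIn ρ b) (ab : adj G a b ≡ true)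
    (few : scarce N S ≡ true) where

    oks : Pointwise (VertexOK ρ) S ρ
    oks = proj₂ real

    near⇒∈ : ∀ z → near G a b z ≡ true → z ∈ ρ
    near⇒∈ z q with ∨-true {adj G a z} q
    ... | inj₁ az = closed-a z az
    ... | inj₂ bz = closed-b z bz

    -- Since `a` and `b` are closed, all vertices near the edge are named and counted by `N`. If
    -- moreover every stranded vertex were among the found ones, the cost of the edge would be below
    -- 10, against `crowded`.
    fresh-stranded : ∃ λ w → stranded G a b w ≡ true × w ∉ select (found N S) ρ
    fresh-stranded with Any.any? (λ w → ¬? (Any.any? (w ≟F_) (select (found N S) ρ))) (filterᵇ (stranded G a b) (allFin n))
    ... | yes some with find some
    ...   | w , w∈ , w∉ = w , proj₂ (∈-filterᵇ⁻ (stranded G a b) {xs = allFin n} w∈) , w∉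
    fresh-stranded | no none = contradiction
      (≤-trans (crowded a b ab) (ℕₚ.+-mono-≤ nears strandeds))
      (<⇒≱ (<ᵇ⇒< _ 10 (≡⇒T few)))
      where
      nears : count (near G a b) (allFin n) ≤ count id N
      nears = ≤-trans
        (unique-⊆⇒length≤ (Uniqueₚ.filter⁺ (T? ∘ near G a b) (Uniqueₚ.allFin⁺ n))
          (λ {z} z∈ → let q = proj₂ (∈-filterᵇ⁻ (near G a b) {xs = allFin n} z∈) in ∈-filterᵇ⁺ (near G a b) (near⇒∈ z q) q))
        (≤-reflexive (≡-sym (count-cong exactN)))
      in-found : ∀ {w} → w ∈ filterᵇ (stranded G a b) (allFin n) → w ∈ select (found N S) ρ
      in-found {w} w∈ with Any.any? (w ≟F_) (select (found N S) ρ)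
      ... | yes q = q
      ... | no  q = contradiction (lose w∈ q) none
      strandeds : count (stranded G a b) (allFin n) ≤ count id (found N S)
      strandeds = ≤-trans
        (unique-⊆⇒length≤ (Uniqueₚ.filter⁺ (T? ∘ stranded G a b) (Uniqueₚ.allFin⁺ n)) in-found)
        (length-select≤ (found N S) ρ)

    module _ {w} (st : stranded G a b w ≡ true) where

      w-active : active G w ≡ true
      w-active = proj₁ (stranded⁻ st)

      far : near G a b w ≡ false
      far = proj₁ (proj₂ (stranded⁻ st))

      bounded : ∀ z → adj G w z ≡ true → near G a b z ≡ true
      bounded = proj₂ (proj₂ (stranded⁻ st))

      w-closed : ClosedIn ρ w
      w-closed z wz = near⇒∈ z (bounded z wz)

      away : ∀ {y} → near G a b y ≡ false → adj G w y ≡ false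
      away {y} q = not-true (λ wy → clash (bounded y wy) q)

      fits-sound : ∀ {N r ρ} → Pointwise (λ m y → m ≡ near G a b y) N ρ → RowOK ρ r w → fits N r ≡ true
      fits-sound [] [] = refl
      fits-sound {true  ∷ N} (_ ∷ e) (_ ∷ row) = fits-sound e row
      fits-sound {false ∷ N} {joined  ∷ r} (m ∷ e) (h ∷ row) = clash h (away (≡-sym m))
      fits-sound {false ∷ N} {apart   ∷ r} (m ∷ e) (h ∷ row) = fits-sound e row
      fits-sound {false ∷ N} {unknown ∷ r} (m ∷ e) (h ∷ row) = fits-sound e row

      -- A stranded vertex is not near the edge and has no neighbour outside `N`, so it passes the
      -- test `fits`; beyond that, a candidate only has to be not yet found.
      named : ∀ {i} → nth ρ i ≡ just w → w ∉ select (found N S) ρ → i ∈ indices (candidates N S)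
      named {i} eqw w∉ with nth⁻ i exactN eqw | nth⁻ i oks eqw
      ... | m , eqm , mw | (c , r) , eqv , (_ , _ , row)
        rewrite trans mw far = indices-∈ (candidates N S) i (trans (nth-zipWith (isCandidate N) {N} {S} i eqm eqv) (cong just candidate))
        where
        not-found : c ∧ surely N r ≡ false
        not-found = not-true (λ q → w∉ (∈-select (found N S) i eqw (trans (nth-zipWith (isFound N) {N} {S} i eqm eqv) (cong just q))))
        candidate : fits N r ∧ not (c ∧ surely N r) ≡ true
        candidate rewrite fits-sound exactN row | not-found = refl

      isolate-sound : ∀ {i} → nth ρ i ≡ just w → Realizes (isolate N i S) ρ
      isolate-sound {i} eqw = proj₁ real , updateAt⁺ i oks confined
        where
        confine-entry : ∀ {m s y} → m ≡ near G a b y → Holds s w y → Holds (if m then s else apart) w y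
        confine-entry {true}  e h = h
        confine-entry {false} e h = away (≡-sym e)
        confined : ∀ {v y} → nth ρ i ≡ just y → VertexOK ρ v y → VertexOK ρ (true , confine N (proj₂ v)) y
        confined eqy (act , _ , row) with just-injective (trans (≡-sym eqw) eqy)
        ... | refl = act , (λ _ → w-closed) , zipWith⁺ exactN row (λ {m} {s} → confine-entry {m} {s})

      new-sound : w ∉ ρ → Realizes (addVertex true (zipWith (λ m v → if m ∧ not (proj₁ v) then unknown else apart) N S) S) (ρ ++ w ∷ [])
      new-sound w∉ = addVertex-sound real w∉ w-active (λ _ → w-closed) (zipWith⁺ exactN oks entry)
        where
        entry : ∀ {m v y} → m ≡ near G a b y → VertexOK ρ v y → Holds (if m ∧ not (proj₁ v) then unknown else apart) w y
        entry {false} e _ = away (≡-sym e)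
        entry {true} {false , _} e _ = tt
        entry {true} {true  , _} {y} e (_ , cl , _) = not-true (λ wy → w∉ (cl refl w (trans (sym G y w) wy)))

    witnesses-sound : Any Realizable (witnesses N S)
    witnesses-sound with fresh-stranded
    ... | w , st , w∉ with Any.any? (w ≟F_) ρ
    ...   | no  new = Anyₚ.++⁺ʳ (map (λ i → isolate N i S) (indices (candidates N S))) (here (_ , new-sound st new))
    ...   | yes old with ∈⇒nth old
    ...     | i , eqw = Anyₚ.++⁺ˡ (Anyₚ.map⁺ (lose (named st eqw w∉) (ρ , isolate-sound st eqw)))

  witness-sound : ∀ {S Ss} u v → witness u v S ≡ just Ss → Realizable S → Any Realizable Ss
  witness-sound {S} u v eq (ρ , real) with nth S u in equ | nth S v in eqv
  witness-sound u v () _ | nothing | _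
  witness-sound u v () _ | just _  | nothing
  witness-sound {S} u v eq (ρ , real) | just p | just q
    with (decided p ∧ decided q) ∧ (isEdge (nth (proj₂ p) v) ∧ scarce (proj₂ p or proj₂ q) S) in legal
  witness-sound {S} u v refl (ρ , real@(_ , oks)) | just p | just q | true
    with ∧-true {decided p ∧ decided q} legal | nth⁺ u oks equ | nth⁺ v oks eqv
  ... | ds , rest | a , _ , okp | b , eqb , okq
    with ∧-true {decided p} ds | ∧-true {isEdge (nth (proj₂ p) v)} rest
  ... | dp , dq | edge , few with decided-sound dp okp | decided-sound dq okq
  ... | cla , rowa | clb , rowb =
    Witness.witnesses-sound real (zipWith⁺ rowa rowb (cong₂ _∨_)) cla clb (joined-ab (proj₂ p) rowa edge) few
    where
    joined-ab : ∀ r → Pointwise (λ s y → isJoined s ≡ adj G a y) r ρ → isEdge (nth r v) ≡ true → adj G a b ≡ true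
    joined-ab r row e with nth⁻ v row eqb
    ... | s , eqs , h rewrite eqs = trans (≡-sym h) e

  -- Soundness of embeddings

  -- Here `r` is the rest of a row from column `k` on, while `p` lists absolute positions; hence the
  -- sum `k + i`.
  outside-sound : ∀ {ρ r x z} k i p → outside k p r ≡ true → RowOK ρ r x → nth ρ i ≡ just z → adj G x z ≡ true →
                  member (k + i) p ≡ true
  outside-sound {r = s ∷ r} k zero p out (h ∷ hs) refl xz with ∨-true {member k p} (proj₁ (∧-true {member k p ∨ isApart s} out))
  ... | inj₁ q rewrite ℕₚ.+-identityʳ k = q
  outside-sound {r = apart ∷ r} k zero p out (h ∷ hs) refl xz | inj₂ q = clash xz h
  outside-sound {r = s ∷ r} k (suc i) p out (h ∷ hs) eq xz rewrite +-suc k i =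
    outside-sound (suc k) i p (proj₂ (∧-true {member k p ∨ isApart s} out)) hs eq xz

  restrict-sound : ∀ {S ρ} p → distinct p ≡ true → Realizes S ρ → Realizes (restrict S p) (pick ρ p)
  restrict-sound {S} {ρ} p d (u , oks) = pick-unique p u d , mapˡ⁺ (pick⁺ oks p) vertex
    where
    vertex : ∀ {v x} → VertexOK ρ v x → VertexOK (pick ρ p) (proj₁ v ∧ outside 0 p (proj₂ v) , pick (proj₂ v) p) x
    vertex {c , r} {x} (act , cl , row) = act , closed , pick⁺ row p
      where
      closed : c ∧ outside 0 p r ≡ true → ClosedIn (pick ρ p) x
      closed q z xz with ∧-true {c} q
      ... | ceq , out with ∈⇒nth (cl ceq z xz)
      ...   | i , eqz = ∈-pick {xs = ρ} p {i} (outside-sound 0 i p out row eqz xz) eqz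

  leStatus-sound : ∀ {s t x y} → leStatus s t ≡ true → Holds t x y → Holds s x y
  leStatus-sound {unknown}        _ _ = tt
  leStatus-sound {joined} {joined} _ h = h
  leStatus-sound {apart}  {apart}  _ h = h

  leRow-sound : ∀ {r s ρ x} → pointwise leStatus r s ≡ true → RowOK ρ s x → RowOK ρ r x
  leRow-sound {[]}    {[]}    _ []       = []
  leRow-sound {s ∷ r} {t ∷ q} e (h ∷ hs) with ∧-true {leStatus s t} e
  ... | e₁ , e₂ = leStatus-sound {s} {t} e₁ h ∷ leRow-sound e₂ hs

  leVertex-sound : ∀ {v w ρ x} → leVertex v w ≡ true → VertexOK ρ w x → VertexOK ρ v x
  leVertex-sound {c , r} {d , s} {ρ} {x} e (act , cl , row) with ∧-true {not c ∨ d} e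
  ... | e₁ , e₂ = act , closed c e₁ , leRow-sound e₂ row
    where
    closed : ∀ c → not c ∨ d ≡ true → c ≡ true → ClosedIn ρ x
    closed true q _ = cl q

  le-sound : ∀ {L S ρ σ} → pointwise leVertex L S ≡ true → Pointwise (VertexOK ρ) S σ → Pointwise (VertexOK ρ) L σ
  le-sound {[]}    {[]}    _ []         = []
  le-sound {v ∷ L} {w ∷ S} e (ok ∷ oks) with ∧-true {leVertex v w} e
  ... | e₁ , e₂ = leVertex-sound {v} {w} e₁ ok ∷ le-sound e₂ oks

  embeds-sound : ∀ {L S} p → embeds L S p ≡ true → Realizable S → Realizable L
  embeds-sound {L} {S} p e (ρ , real) with ∧-true {distinct p} e
  ... | d , le with restrict-sound p d real
  ...   | u , oks = pick ρ p , u , le-sound le oks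

  -- Soundness of the checker

  nth-All : ∀ {P : State → Set} {Ss S} i → All P Ss → nth Ss i ≡ just S → P S
  nth-All zero    (p ∷ ps) refl = p
  nth-All (suc i) (p ∷ ps) eq   = nth-All i ps eq

  embedding-sound : ∀ {ctx S ts′} ts → embedding ctx S ts ≡ just ts′ → All Refuted ctx → Refuted S
  embedding-sound {ctx} {S} (j ∷ ts) eq ref with nth ctx j in eqj
  ... | just L with splitAt (length L) ts
  ...   | p , _ with embeds L S p in e
  ...     | true = λ real → nth-All j ref eqj (embeds-sound p e real)

  refute : ∀ {Ss} → All Refuted Ss → Any Realizable Ss → HasC52 G
  refute (r ∷ _)  (here real)  = r real
  refute (_ ∷ rs) (there any′) = refute rs any′

  -- There is no circularity in using the context: a state joins it only after its own subtree has
  -- been accepted, with a context that did not yet contain it.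
  check-sound     : ∀ f {ctx S ts′} ts → check δ f ctx S ts ≡ just ts′ → All Refuted ctx → Refuted S
  checkAll-sound  : ∀ f {ctx Ss ts′} ts → checkAll δ f ctx Ss ts ≡ just ts′ → All Refuted ctx → All Refuted Ss
  checkNext-sound : ∀ f {ctx S Ss ts′} ts → checkNext δ f ctx S Ss ts ≡ just ts′ → All Refuted ctx → Refuted S × All Refuted Ss

  check-sound (suc f) (0 ∷ x ∷ y ∷ ts) eq ref real = refute (checkAll-sound f ts eq ref) (split-sound x y real)
  check-sound (suc f) (1 ∷ x ∷ ts)     eq ref real = refute (checkAll-sound f ts eq ref) (extend-sound x real)
  check-sound (suc f) {S = S} (2 ∷ u ∷ v ∷ ts) eq ref real with witness u v S in eqw
  ... | just Ss = refute (checkAll-sound f ts eq ref) (witness-sound u v eqw real)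
  check-sound (suc f) (3 ∷ ts) eq ref = embedding-sound ts eq ref

  checkAll-sound f {Ss = []}     ts eq ref = []
  checkAll-sound f {Ss = S ∷ Ss} ts eq ref with checkNext-sound f ts eq ref
  -- Normalising only draws consequences, so the same `ρ` realizes the normal form.
  ... | r , rs = (λ (ρ , real) → r (ρ , normalise-sound real)) ∷ rs

  checkNext-sound f {ctx} {S} ts eq ref with any (absurdVertex δ) S in bad
  ... | true  = (λ (ρ , real) → ⊥-elim (absurd-sound real bad)) , checkAll-sound f ts eq ref
  ... | false with check δ f ctx S ts in eqc
  ...   | just ts₁ with check-sound f ts eqc ref
  ...     | r = r , checkAll-sound f ts₁ eq (r ∷ ref)

  -- Soundness of the initial states

  free-sound : ∀ {xs} → All (λ x → active G x ≡ true) xs →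
               Pointwise (λ v x → active G x ≡ true × proj₁ v ≡ false × RowOK xs (proj₂ v) x) (free (length xs)) xs
  free-sound []         = []
  free-sound {x ∷ xs} (act ∷ acts) =
    (act , refl , irrefl G x ∷ unknowns xs)
    ∷ mapˡ⁺ (free-sound acts) (λ (act , open′ , row) → act , open′ , tt ∷ row)
    where
    unknowns : ∀ ys → RowOK ys (replicate (length ys) unknown) x
    unknowns []       = []
    unknowns (_ ∷ ys) = tt ∷ unknowns ys

  -- The degree of `u` is by definition the length of `nbrs`, so the rows of the star match this
  -- list without any transport.
  star-sound : ∀ u → active G u ≡ true → Realizable (star (degree G u))
  star-sound u act =
    u ∷ nbrs
    , All.tabulate (λ {y} y∈ u≡y → clash (subst (λ z → adj G u z ≡ true) (≡-sym u≡y) (uy y∈)) (irrefl G u))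
        ∷ Uniqueₚ.filter⁺ (T? ∘ adj G u) (Uniqueₚ.allFin⁺ n)
    , (act , (λ _ z uz → there (∈-filterᵇ⁺ (adj G u) (∈-allFin z) uz)) , irrefl G u ∷ joins nbrs uy)
      ∷ spokes
    where
    nbrs : List V
    nbrs = filterᵇ (adj G u) (allFin n)
    uy : ∀ {y} → y ∈ nbrs → adj G u y ≡ true
    uy y∈ = proj₂ (∈-filterᵇ⁻ (adj G u) {xs = allFin n} y∈)
    joins : ∀ ys → (∀ {y} → y ∈ ys → adj G u y ≡ true) → RowOK ys (replicate (length ys) joined) u
    joins []       h = []
    joins (y ∷ ys) h = h (here refl) ∷ joins ys (h ∘ there)
    spoke : ∀ {ys v y} → active G y ≡ true × proj₁ v ≡ false × RowOK ys (proj₂ v) y → adj G u y ≡ true →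
            VertexOK (u ∷ ys) (map₂ (joined ∷_) v) y
    spoke {v = false , _} {y} (act , refl , row) uy = act , (λ ()) , trans (sym G y u) uy ∷ row
    attach : ∀ {ρ S ys} → Pointwise (λ v x → active G x ≡ true × proj₁ v ≡ false × RowOK ρ (proj₂ v) x) S ys →
             (∀ {y} → y ∈ ys → adj G u y ≡ true) → Pointwise (VertexOK (u ∷ ρ)) (map (map₂ (joined ∷_)) S) ys
    attach []       h = []
    attach {S = v ∷ _} (p ∷ ps) h = spoke {v = v} p (h (here refl)) ∷ attach ps (h ∘ there)
    spokes : Pointwise (VertexOK (u ∷ nbrs)) (map (map₂ (joined ∷_)) (free (length nbrs))) nbrs
    spokes = attach (free-sound (All.tabulate λ {y} y∈ → any⁺ (adj G y) (∈-allFin u) (trans (sym G y u) (uy y∈)))) uy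

  blownUpC5-sound : Refuted blownUpC5
  blownUpC5-sound (ρ , u , oks) = f , f-injective , f-adj
    where
    vertex : ∀ a → nth blownUpC5 (toℕ a) ≡ just (false , map (λ b → if c52adj a b then joined else apart) (allFin 10))
    vertex = nth-map-allFin (λ a → false , map (λ b → if c52adj a b then joined else apart) (allFin 10))
    f : Fin 10 → V
    f a = proj₁ (nth⁺ (toℕ a) oks (vertex a))
    f-nth : ∀ a → nth ρ (toℕ a) ≡ just (f a)
    f-nth a = proj₁ (proj₂ (nth⁺ (toℕ a) oks (vertex a)))
    f-injective : Injective _≡_ _≡_ f
    f-injective {a} {b} e = toℕ-injective (nth-unique (toℕ a) (toℕ b) u (f-nth a) (trans (f-nth b) (cong just (≡-sym e))))
    f-adj : ∀ a b → adj G (f a) (f b) ≡ c52adj a b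
    f-adj a b with nth⁺ (toℕ a) oks (vertex a)
    ... | x , _ , _ , _ , row with nth⁺ (toℕ b) row (nth-map-allFin (λ b → if c52adj a b then joined else apart) b)
    ...   | y , eqy , h rewrite just-injective (trans (≡-sym (f-nth b)) eqy) = read (c52adj a b) h
      where
      read : ∀ c → Holds (if c then joined else apart) x y → adj G x y ≡ c
      read true  h = h
      read false h = h

  run-sound : ∀ s u → run δ s ≡ just [] → active G u ≡ true → degree G u ≡ δ → HasC52 G
  run-sound s u eq act refl with checkAll-sound 400 {Ss = star (degree G u) ∷ []} (tokens s) eq (blownUpC5-sound ∷ [])
  ... | r ∷ [] = r (star-sound u act)

-- Certificates for minimum positive degree 1, 2, 3 and 4

certificate1 : List String
certificate1 =
  "1120111201032201042201052201112010420432010520532010620632012010732010633001324562010620633001234620" ∷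
  "1073225063201072300123457073310132467053300132452010520533001235201062063310123620107322406320107230" ∷
  "0123457073201082310123458083320132678053201062300123460633101325604330013242010520530542010620630642" ∷
  "0107207307420120108420107430012435672010830843101342568201094227084300124356780733001324567074310142" ∷
  "3567201072073074300123457201084226074201083084201236084300124357682010830843001324568201094226084201" ∷
  "0933001234567909424807330013245670742010823101234568083320132456808424706430012435620107207331012345" ∷
  "7074320124357201083084330134258201093094340134259226226094226084300124356780730743201342572010823101" ∷
  "2345680833201324578084201092330123456909334013245790943501423589074300124356706330013245606431014235" ∷
  "6201062063064300123462010720730743101234720108422507420108308422523508420109330012345679094247201083" ∷
  "0843001324568201094225084201093300123456790942250:33101234567:07330013245670742010823101234568083320" ∷
  "1324568084201092330123456909334013245690942470642010720733001234570743101243672010830842272010930943" ∷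
  "0012345679235094227084300124365780730742010823001234568083310132457808432014236782010823101234568083" ∷
  "0843201324587237084201092330123456909331012345679094320124365890743001243657201072073310123457074310" ∷
  "123457201083084320132458201093094330132459225226094226084201093300123456790942250:33101234567:073074" ∷
  "3101324572010823101234568083320132457808420109233012345690933401324579094023223024224123;62152250;30" ∷
  ";:237390132457;0;:2250<3300123456789:<0<:2260=:22607420108231012345680833101234568084201092330123456" ∷
  "9094093350132459247093340123456906330013245606420107231012345707332013245707420108408233012345808334" ∷
  "0132458246082340123458083350132458054300124352010620633101234606432012436201072073330123470743401243" ∷
  "7201083084350134282010930943601342922522509422508430012435678073074340134272010823101234568083084360" ∷
  "13428201092330123456909334013247890940232230242250:43001243569:7123<52162250;:2250<:2250=:3852:16;<=" ∷
  "0842010923301234569093310123456790943201243568907430012435670630643201342620107231012345707332013246" ∷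
  "70742010823301234580833401324680843501423780643001243560533001324505431014235" ∷ []

verified1 : run 1 certificate1 ≡ just []
verified1 = refl

certificate2 : List String
certificate2 =
  "0121120111201042043201052053201201201201201201023024053054063025063064073053054034062036072062320123" ∷
  "4657890243001243567890250260730740830840930540630640273001234576890730740283101234586790830540530540" ∷
  "3403607230012347568906231012346578903603708231012348567907232012347568906232012346578911112010420432" ∷
  "0105205320106206320111201201201201201023024025063064073053054026300123465789063064025026073074083063" ∷
  "0640273001234576890730540740530540343353403607231012347568906232012346578902430012435678902502602708" ∷
  "3084093094202073074028300123456879083084029310123456978093054063064027300123457689073074034035082310" ∷
  "1234586790543001243567890530540343453403603708231012348567907232012347568906232012346578920120120120" ∷
  "1023024025034035064036074064300124356789035300123546789036037084085094065074075038300123456879084310" ∷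
  "1243578690640650453001243567890262020730740830730742023001234567890830843001234567983101234567:83001" ∷
  "23456879310123456978320123456:780273001234576890283101234586790293201234596781235021342023402134:567" ∷
  "80630642023502134:5678073074300123456879:310123456978:2023902134:5678330123456789:340123456879:35012" ∷
  "3456978:2023=02134:5678370123456789:380123456879:390123456978:03403507403:3002134:6;<=57890370840743" ∷
  "00124356789:;<=300123457689:310123458679:320123459678:2023902134:5678340123456789:350123457689:36012" ∷
  "3458679:370123459678:2023>02134:5678390123456789:3:0123457689:3;0123458679:3<0123459678:2023C02134:5" ∷
  "6783>0123456789:3?0123457689:3@0123458679:3A0123459678:03403506403:3002134:;<=>567890360740643001243" ∷
  "56789:;<=>03503:06406507403607407508406406504504:073047083073320123457689:;<=>03:3002134:;<=>5678903" ∷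
  "6037084085094074075038300123456879:;<=>084310124357869:;<=>0640650453P64504:3302143:;<=>567893201243" ∷
  "56789:;<=>025300123546789026027202083085093095202300123546789028300123456879029310123456978123502136" ∷
  "202073075083300123546789:0;30;:202310123456789:320123546789:0<30740750840850940650273001234576890283" ∷
  "101234586790293201234596781237021312370213:202063065073300123546789:;202310123456789:;320123546789:;" ∷
  "202330123456789:;340123546789:;2023;0213:;4<=>3<0213:;5<=>03403506406507403:06406507403;300123456789" ∷
  ";:<=>?0360740750840640650453F64504:07304;300123456789;:<=>?047083073340123457689:;<=>?03530012354678" ∷
  "9:;<=>?03:310213:;<=>?45678903;320213;:<=>?4567890360370840850940950<:0<;0=:0=;0>:074075038300123456" ∷
  "879:;<=>?084085039310123456978:;<=>?0940650640650453G64504:04;073310123457689:;<=>?04708332012345867" ∷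
  "9:;<=>?073330123457689:;<=>?04;300123456789;:<=>?047048093330123459678:;<=>?083340123458679:;<=>?073" ∷
  "340123457689:;<=>?0243001243567890253101253467890260270282020940952023001243567893101253467890293001" ∷
  "23456798123502167202084085094095202300124356789:310125346789:028300123456879029310123456978123702161" ∷
  "2370216:202074075084085094095063214300124356789:;310125346789:;0<:0<;202320123456789:;330124356789:;" ∷
  "340125346789:;0=:0=;202350123456789:;360124356789:;370125346789:;0>:0>;22:02730012345768902831012345" ∷
  "8679029320123459678121238021:1238021:;202064065074075084300124356789:;<310125346789:;<20232012345678" ∷
  "9:;<330124356789:;<340125346789:;<202350123456789:;<360124356789:;<370125346789:;<2023>021:;<3=>?3?0" ∷
  "21:;<4=>?3@021:;<5=>?03403503:06406507403;300123456789;:<=>?@03<310123456789<:;=>?@03607407508406406" ∷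
  "504504:07304;300123456789;:<=>?@04<310123456789<:;=>?@047083073340123457689:;<=>?@03:03;06406507403<" ∷
  "300123456789:<;=>?@0360740750840640650453K64504:310124356789:;<=>?@04;320124356789;:<=>?@04<33012435" ∷
  "6789<:;=>?@047083073350123457689:;<=>?@03;300123456789;:<=>?@03<310123456789<:;=>?@03603708408509406" ∷
  "5075074075038300123456879:;<=>?@084310124357869:;<=>?@0640650453L64504:340124356789:;<=>?@04;3501243" ∷
  "56789;:<=>?@04<360124356789<:;=>?@340124356789:;<=>?@035300123546789:;<=>?@03:03;03<3C021:;<3=>?0360" ∷
  "74075084085094065064065037300123457689:;<=>?@074075038310123458679:;<=>?@08408503<300123456789:<;=>?" ∷
  "@036037084085094095064075214065300123546789:;<=>?@074075038300123456879:;<=>?@084085039310123456978:" ∷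
  ";<=>?@0940650640650453L64504:04;330124356789:;<=>?@04<340124356789:<;=>?@330124356789:;<=>?@04;04<34" ∷
  "0124356789;<:=>?@330124356789;:<=>?@04<330124356789<:;=>?@047048093340123459678:;<=>?@08335012345867" ∷
  "9:;<=>?@073350123457689:;<=>?@03;300123456789;:<=>?@03<310123456789<:;=>?@0360370380940952130A40A506" ∷
  "4075065300123546789:;<=>?@A084085039300123456798:;<=>?@094095064310124356897:;<=>?@065320125346897:;" ∷
  "<=>?@074075038300123456879:;<=>?@084085045046310124356789:;<=>?@065320125346789:;<=>?@0640650453M645" ∷
  "04:340124356789:;<=>?@04;350124356789;:<=>?@04<360124356789<:;=>?@340124356789:;<=>?@" ∷ []

verified2 : run 2 certificate2 ≡ just []
verified2 = refl

certificate3 : List String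
certificate3 =
  "0120131120120105205305420106206306420111112010520530542010620630642012012012012010233102130240250630" ∷
  "6406507307402607307407508308406306406502730012345768907307407508202530012354678902602708308408509309" ∷
  "4095202073074075028300123456879083084085029310123456978093064063064065027300123457689073074075034035" ∷
  "0380923101234596780823201234586790133001321111112012012012010233102310240250260730740750830840630640" ∷
  "6502730012345768907307407502602708308408509309406307307407502830012345687908308431104523786906306406" ∷
  "5027300123457689073074311045236789025300123546789026027028093094095202083084085029300123456798093094" ∷
  "0951220220207307407502830012345687908308408502931012345697809332013245786906306406502730012345768907" ∷
  "3074075034035310132456789201201201023320231024025026034035036074037084074075036300123465789037038094" ∷
  "0750760850840750760850740750760833001234568790353001235467890363101236457890370380392032032030470480" ∷
  "9509621408508623807530012354678930012346578930012354678931012364578909409509613350312782030840850860" ∷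
  "3930012345679809407507407507603830012345687908408502720208308408509309409506308308408520230012345678" ∷
  "909309409507307620230012345678:3001234567983101234567:8028300123456879029310123456978123502134520233" ∷
  "021345:67807307407520234021345:678083084085300123456798:20237021345:678320123456789:330123456798:034" ∷
  "3?73450353@735403603:08403809408408503:30021345:7;<6890380390;4094085084085300123456879:310123456978" ∷
  ":20237021345:678330123456789:340123456879:350123456978:2023;021345:678370123456789:380123456879:3901" ∷
  "23456978:0640650633?021345:67806:3@021345:6780673<0123456879:3=0123456789:06306:3@021345:6780673<012" ∷
  "3456879:3=0123456789:06:0673<0123456879:3=0123456789:0670683=0123456978:3>0123456879:3>0123456789:06" ∷
  "5300123546789:;<=06306:0673<0123456879:3=0123456789:0670683=0123456978:3>0123456879:3>0123456789:06:" ∷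
  "0670683=0123456978:3>0123456879:3>0123456789:0670680692160;40;50;:0<43?0123456978:3?0123456879:3?012" ∷
  "3456789:02630012346578902702820209309409620230012346578902930012345679812350213472020830840860930940" ∷
  "96202300123465789:0;30;40;:202310123456789:320123465789:0<30<408302830012345687902931012345697812123" ∷
  "602134:202073074076083084300123465789:;202310123456789:;320123465789:;2023702134:;5<=3802134:;6<=034" ∷
  "0353;01324567890363<013246578903:3=02314:;<=>03;3>02314;:<=>0373=01324567890740750760833>01324568790" ∷
  "350363<013256478903:03;3=0231:;4<=>0373<01325467890740750760383=013254687908408503;300123456789;:<=>" ∷
  "0373=01325467890740750760383>0132546879084085036300123465789:;<=>03:3102134:;<=>5678903;3202134;:<=>" ∷
  "567890370380390<40<:0<;0=409409509603<0=40<40750760850860<:0<;0=3084085086039300123456798:;<=>094075" ∷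
  "0760950960<30<:0<;0=3074075076038300123456879:;<=>084085086093310123456978:;<=>025300123546789026310" ∷
  "1236457890270280292022022020433201324567890470480492140733302317894560750762472270680692160763001234" ∷
  "6578921409509621404930012345679804830012345687930012346578930012354678931012364578912350213782020930" ∷
  "95096202300123546789:310123645789:02930012345679812123602137:2020830850860930950962020<3320132456897" ∷
  "300123546789:;310123645789:;0<30<:0<;202320123456789:;330123546789:;340123645789:;0=30=:0=;202350123" ∷
  "456789:;360123546789:;370123645789:;0>33;02317:;<=>028300123456879029310123456978121212370213:;20207" ∷
  "3075076083085086093330132456789300123546789:;<310123645789:;<202320123456789:;<330123546789:;<340123" ∷
  "645789:;<202390213:;<4=>3:0213:;<5=>3;0213:;<6=>0343?01324567890353@01325467890363A013264578903:3B02" ∷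
  "31:;<=>?03;3C0231;:<=>?03<3D0231<:;=>?0373B01324567890740750760383C01324568790840850860393D013245697" ∷
  "8094095096214" ∷ []

verified3 : run 3 certificate3 ≡ just []
verified3 = refl

certificate4 : List String
certificate4 =
  "0120130142011120106206306406520107207307407520101430012431111201072073074075201082083084085201093094" ∷
  "0950962020862010930940950962020850862010930940950962020843001243567808308408508620109230012345679093" ∷
  "0940950962370763001234657075076301025634707430012435670730740750762010823001234568083084085086201093" ∷
  "0940950962370923201234569092320123456909232012345690923201234569013300132401431014231111112010820830" ∷
  "840852010920930940950233202314024330241302534258090262280:30:40:50:6202027300123457689122280;30;40;5" ∷
  "0;:20209602333023140243402413025352580902636269080272280:30:40:50:7202122280;30;40;50;:2020973001234" ∷
  "5768909509602333023140253425809024350241302636269080272280:30:40:50:7228122280;30;40;50;:20309730012" ∷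
  "345768909609702334023140243502413025362580902637269080273827908122280;30;40;50;:22809430012435678909" ∷
  "509609702534258090233502314024360241302637269080273827908122280;30;40;50;:22809330013245678909431014" ∷
  "2356789086300123465780873101234756808508620109209309509602333023140253425809026352680902436024130272" ∷
  "020533735809057381570605420206339368090642150343:034120372280473<01582746930673;16705300123465789122" ∷
  "2804338034120453110567234890;30;5363089;124509431012345679097023350231402536258090263726809027382790" ∷
  "80243902413122280433:0341204504604:2040;30;5383089;1245096300123465789094320123456790950963010567234" ∷
  "8909409702535258090233602314024370241302638268090273927908122280453:549180433;0341204604:392809:3564" ∷
  "0;30;50;6388235609:;09409630012346578909330013245678909409531105672348908730012345768086300123465780" ∷
  "8430012435678085086311056723480833001324567808431014235678" ∷ []

verified4 : run 4 certificate4 ≡ just []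
verified4 = refl

-- A cheap edge or an induced C_5^2

dichotomy : ∀ b → b ≡ true ⊎ b ≡ false
dichotomy true  = inj₁ refl
dichotomy false = inj₂ refl

does-true : ∀ {A : Set} (a? : Dec A) → does a? ≡ true → A
does-true (yes a) _ = a

all⁺ : ∀ {A : Set} (p : A → Bool) xs → (∀ x → p x ≡ true) → all p xs ≡ true
all⁺ p []       h = refl
all⁺ p (x ∷ xs) h rewrite h x = all⁺ p xs h

count-mono : ∀ {A : Set} {p q : A → Bool} → (∀ x → p x ≡ true → q x ≡ true) → ∀ xs → count p xs ≤ count q xs
count-mono h [] = z≤n
count-mono {p = p} {q} h (x ∷ xs) with p x in eq
... | true rewrite h x eq = s≤s (count-mono h xs)
... | false with q x
...   | true  = m≤n⇒m≤1+n (count-mono h xs)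
...   | false = count-mono h xs

count-∨ : ∀ {A : Set} (p q : A → Bool) xs → count (λ x → p x ∨ q x) xs ≤ count p xs + count q xs
count-∨ p q [] = z≤n
count-∨ p q (x ∷ xs) with p x | q x
... | false | false = count-∨ p q xs
... | true  | false = s≤s (count-∨ p q xs)
... | false | true  = ≤-trans (s≤s (count-∨ p q xs)) (≤-reflexive (≡-sym (+-suc (count p xs) (count q xs))))
... | true  | true  = s≤s (≤-trans (count-∨ p q xs) (ℕₚ.+-monoʳ-≤ (count p xs) (m≤n⇒m≤1+n ≤-refl)))

length≤count+filter : ∀ {A : Set} {Q : A → Set} (p : A → Bool) (Q? : ∀ x → Dec (Q x)) → (∀ x → p x ≡ false → Q x) →
                      ∀ xs → length xs ≤ count p xs + length (filter Q? xs)
length≤count+filter p Q? h [] = z≤n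
length≤count+filter p Q? h (x ∷ xs) with p x in eq | Q? x
... | true  | yes _ = s≤s (≤-trans (length≤count+filter p Q? h xs) (ℕₚ.+-monoʳ-≤ (count p xs) (m≤n⇒m≤1+n ≤-refl)))
... | true  | no _  = s≤s (length≤count+filter p Q? h xs)
... | false | yes _ = ≤-trans (s≤s (length≤count+filter p Q? h xs)) (≤-reflexive (≡-sym (+-suc (count p xs) _)))
... | false | no ¬q = contradiction (h x eq) ¬q

module _ {n} (G : Graph n) where

  active⁺ : ∀ {x z} → adj G x z ≡ true → active G x ≡ true
  active⁺ {x} {z} xz = any⁺ (adj G x) (∈-allFin z) xz

  active⁻ : ∀ {x} → active G x ≡ true → ∃ λ z → adj G x z ≡ true
  active⁻ {x} act with any⁻ (adj G x) (allFin n) act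
  ... | z , _ , xz = z , xz

  crowd : Fin n → Fin n → ℕ
  crowd u v = count (near G u v) (allFin n) + count (stranded G u v) (allFin n)

  -- If no edge costs at most 9, the graph is crowded. The minimum degree of its active vertices is
  -- then located by raising a lower bound from 1 until it is attained; `x` being active, this
  -- happens by 4, and the certificate for that value applies.
  good-edge-or-C52 : MaxDegreeAtMost G 4 → ∀ {x} → active G x ≡ true →
                     HasC52 G ⊎ ∃₂ λ u v → adj G u v ≡ true × crowd u v ≤ 9
  good-edge-or-C52 Δ≤4 {x} act-x with anyF? (λ u → anyF? (λ v → (adj G u v ≟B true) ×-dec (crowd u v ≤? 9)))
  ... | yes good = inj₂ good
  ... | no ¬good = inj₁ (from1 positive)
    where
    crowded : ∀ u v → adj G u v ≡ true → 10 ≤ crowd u v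
    crowded u v uv = ≰⇒> (λ le → ¬good (u , v , uv , le))
    positive : ∀ y → active G y ≡ true → 1 ≤ degree G y
    positive y act with active⁻ act
    ... | z , yz = unique-⊆⇒length≤ {xs = z ∷ []} ([] ∷ []) λ { (here refl) → ∈-filterᵇ⁺ (adj G y) (∈-allFin z) yz }
    MinDegree : ℕ → Set
    MinDegree δ = ∀ y → active G y ≡ true → δ ≤ degree G y
    attained : ∀ {δ} → MinDegree δ → (∃ λ u → active G u ≡ true × degree G u ≡ δ) ⊎ MinDegree (suc δ)
    attained {δ} min with anyF? (λ u → (active G u ≟B true) ×-dec (degree G u ℕₚ.≟ δ))
    ... | yes found = inj₁ found
    ... | no ¬found = inj₂ (λ y act → ℕₚ.≤∧≢⇒< (min y act) (λ e → ¬found (y , act , ≡-sym e)))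
    from4 : MinDegree 4 → HasC52 G
    from4 min with attained min
    ... | inj₁ (u , act , e) = Soundness.run-sound G 4 Δ≤4 min crowded certificate4 u verified4 act e
    ... | inj₂ min′          = contradiction (Δ≤4 x) (<⇒≱ (min′ x act-x))
    from3 : MinDegree 3 → HasC52 G
    from3 min with attained min
    ... | inj₁ (u , act , e) = Soundness.run-sound G 3 Δ≤4 min crowded certificate3 u verified3 act e
    ... | inj₂ min′          = from4 min′
    from2 : MinDegree 2 → HasC52 G
    from2 min with attained min
    ... | inj₁ (u , act , e) = Soundness.run-sound G 2 Δ≤4 min crowded certificate2 u verified2 act e
    ... | inj₂ min′          = from3 min′
    from1 : MinDegree 1 → HasC52 G
    from1 min with attained min
    ... | inj₁ (u , act , e) = Soundness.run-sound G 1 Δ≤4 min crowded certificate1 u verified1 act e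
    ... | inj₂ min′          = from2 min′

-- Copies of C_5^2 are components

c52-degree : ∀ a → count (c52adj a) (allFin 10) ≡ 4
c52-degree = from-yes (allF? (λ a → count (c52adj a) (allFin 10) ℕₚ.≟ 4))

c52-neighbour : ∀ a → ∃ λ b → c52adj a b ≡ true
c52-neighbour = from-yes (allF? (λ a → anyF? (λ b → c52adj a b ≟B true)))

-- Connectedness in a form decidable by enumeration; `fz` reaches itself by going out and back.
c52-diameter : ∀ a → c52adj fz a ≡ true ⊎ (∃ λ b → c52adj fz b ≡ true × c52adj b a ≡ true)
c52-diameter = from-yes (allF? (λ a → (c52adj fz a ≟B true) ⊎-dec
                                       anyF? (λ b → (c52adj fz b ≟B true) ×-dec (c52adj b a ≟B true))))

module _ {n} {G : Graph n} (Δ≤4 : MaxDegreeAtMost G 4) where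

  -- All vertices of a C_5^2 have degree 4 within it, so it is closed under adjacency.
  c52-closed : ∀ {f} → IsC52 G f → ∀ a x → adj G (f a) x ≡ true → ∃ λ b → f b ≡ x
  c52-closed {f} (inj , iso) a x ax with anyF? (λ b → f b ≟F x)
  ... | yes found = found
  ... | no ¬found = contradiction (Δ≤4 (f a)) (<⇒≱ (≤-trans
    (≤-reflexive (cong suc (≡-sym (trans (length-map f nbrs) (c52-degree a)))))
    (unique-⊆⇒length≤ {xs = x ∷ map f nbrs}
      (All.tabulate (λ y∈ x≡y → let b , _ , e = ∈-map⁻ f y∈ in ¬found (b , ≡-sym (trans x≡y e)))
        ∷ Uniqueₚ.map⁺ inj (Uniqueₚ.filter⁺ (T? ∘ c52adj a) (Uniqueₚ.allFin⁺ 10)))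
      λ y∈ → ∈-filterᵇ⁺ (adj G (f a)) (∈-allFin _) (adjacent y∈))))
    where
    nbrs : List (Fin 10)
    nbrs = filterᵇ (c52adj a) (allFin 10)
    adjacent : ∀ {y} → y ∈ x ∷ map f nbrs → adj G (f a) y ≡ true
    adjacent (here refl) = ax
    adjacent (there y∈) with ∈-map⁻ f y∈
    ... | b , b∈ , refl = trans (iso a b) (proj₂ (∈-filterᵇ⁻ (c52adj a) {xs = allFin 10} b∈))

  c52-reach-inside : ∀ {f} → IsC52 G f → ∀ {y u} a → f a ≡ y → Reachable G y u → ∃ λ b → f b ≡ u
  c52-reach-inside C a e here = a , e
  c52-reach-inside C a refl (step yz r) with c52-closed C a _ yz
  ... | b , e = c52-reach-inside C b e r

  c52-component : ∀ {f} → IsC52 G f → ComponentIsC52 G (f fz)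
  c52-component {f} C@(inj , iso) = f , inj , iso , reach , λ u r → c52-reach-inside C fz refl r
    where
    reach : ∀ a → Reachable G (f fz) (f a)
    reach a with c52-diameter a
    ... | inj₁ e            = step (trans (iso fz a) e) here
    ... | inj₂ (b , e , e′) = step (trans (iso fz b) e) (step (trans (iso b a) e′) here)

-- Deleting a vertex set

module _ {n} (G : Graph n) (D : Fin n → Bool) where

  -- The vertex type stays `Fin n` and only edges disappear. Deleted and stranded vertices are then
  -- alike, namely inactive, and progress is measured by the number of active vertices.
  delete : Graph n
  delete = record
    { adj    = λ x y → adj G x y ∧ (not (D x) ∧ not (D y))
    ; sym    = λ x y → symmetric (sym G x y) (D x) (D y)
    ; irrefl = λ x → cong (_∧ (not (D x) ∧ not (D x))) (irrefl G x)
    }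
    where
    symmetric : ∀ {a b} → a ≡ b → ∀ c d → a ∧ (not c ∧ not d) ≡ b ∧ (not d ∧ not c)
    symmetric refl true  true  = refl
    symmetric refl true  false = refl
    symmetric refl false true  = refl
    symmetric refl false false = refl

  delete⁻ : ∀ {x y} → adj delete x y ≡ true → adj G x y ≡ true × D x ≡ false × D y ≡ false
  delete⁻ {x} {y} e with adj G x y | D x | D y
  delete⁻ refl | true | false | false = refl , refl , refl

  delete-outside : ∀ {x y} → D x ≡ false → D y ≡ false → adj delete x y ≡ adj G x y
  delete-outside {x} {y} dx dy rewrite dx | dy with adj G x y
  ... | true  = refl
  ... | false = refl

  delete-maxDegree : MaxDegreeAtMost G 4 → MaxDegreeAtMost delete 4
  delete-maxDegree Δ≤4 x = ≤-trans (count-mono (λ y e → proj₁ (delete⁻ e)) (allFin n)) (Δ≤4 x)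

  delete-active : ∀ {x} → active delete x ≡ true → active G x ≡ true
  delete-active act with active⁻ delete act
  ... | z , xz = active⁺ G (proj₁ (delete⁻ xz))

  delete-inactive : ∀ {x} → D x ≡ true → active delete x ≡ false
  delete-inactive dx = not-true λ act → let z , xz = active⁻ delete act in clash dx (proj₁ (proj₂ (delete⁻ xz)))

-- Packings and the two reductions

image : ∀ {n} → (Fin 10 → Fin n) → Fin n → Bool
image f z = does (anyF? (λ a → f a ≟F z))

image⁺ : ∀ {n} {f : Fin 10 → Fin n} {z} → (∃ λ a → f a ≡ z) → image f z ≡ true
image⁺ {f = f} {z} e = dec-true (anyF? (λ a → f a ≟F z)) e

image⁻ : ∀ {n} {f : Fin 10 → Fin n} {z} → image f z ≡ true → ∃ λ a → f a ≡ z
image⁻ {f = f} {z} e = does-true (anyF? (λ a → f a ≟F z)) e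

IsEdge : ∀ {n} → Graph n → Fin n × Fin n → Set
IsEdge G (a , b) = adj G a b ≡ true

Disjoint : ∀ {n} → (Fin 10 → Fin n) → (Fin 10 → Fin n) → Set
Disjoint f g = ∀ a b → f a ≢ g b

-- This is the bookkeeping of the induction. A copy of `C_5^2` also supplies an edge to `matching`,
-- so its ten vertices are paid for as 9 + 1 in `covers`.
record Packing {n} (G : Graph n) : Set where
  field
    matching  : List (Fin n × Fin n)
    copies    : List (Fin 10 → Fin n)
    edges     : All (IsEdge G) matching
    separated : AllPairs (Separated G) matching
    are-C52   : All (IsC52 G) copies
    disjoint  : AllPairs Disjoint copies
    covers    : count (active G) (allFin n) ≤ 9 * length matching + length copies
open Packing

-- Common ground of the two reductions: `D` is either exactly the set near `uv` or the vertex set of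
-- a copy containing `uv`. Containing everything near the edge, it separates `uv` from whatever is
-- chosen afterwards.
module Deletion {n} (G : Graph n) (D : Fin n → Bool) {u v}
  (uv : adj G u v ≡ true) (near⇒D : ∀ z → near G u v z ≡ true → D z ≡ true) where

  H : Graph n
  H = delete G D

  Outside : Fin n × Fin n → Set
  Outside (a , b) = adj G a b ≡ true × D a ≡ false × D b ≡ false

  edges-outside : ∀ {M} → All (IsEdge H) M → All Outside M
  edges-outside = All.map (delete⁻ G D)

  outside≢ : ∀ {x y} → D x ≡ true → D y ≡ false → x ≢ y
  outside≢ dx dy refl = clash dx dy

  Du : D u ≡ true
  Du = near⇒D u (∨-trueʳ _ (trans (sym G v u) uv))

  Dv : D v ≡ true
  Dv = near⇒D v (∨-trueˡ _ uv)

  separated-first : ∀ {e} → Outside e → Separated G (u , v) e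
  separated-first {c , d} (_ , dc , dd) =
    (outside≢ Du dc , outside≢ Du dd , outside≢ Dv dc , outside≢ Dv dd) ,
    (far-u dc , far-u dd , far-v dc , far-v dd)
    where
    far-u : ∀ {z} → D z ≡ false → adj G u z ≡ false
    far-u dz = not-true λ e → clash (near⇒D _ (∨-trueˡ _ e)) dz
    far-v : ∀ {z} → D z ≡ false → adj G v z ≡ false
    far-v dz = not-true λ e → clash (near⇒D _ (∨-trueʳ _ e)) dz

  separated-lift : ∀ {e e′} → Outside e → Outside e′ → Separated H e e′ → Separated G e e′
  separated-lift (_ , da , db) (_ , dc , dd) (ne , (p , q , r , s)) =
    ne , (lift da dc p , lift da dd q , lift db dc r , lift db dd s)
    where
    lift : ∀ {x y} → D x ≡ false → D y ≡ false → adj H x y ≡ false → adj G x y ≡ false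
    lift dx dy e = trans (≡-sym (delete-outside G D dx dy)) e

  all-separated : ∀ {M} → All Outside M → AllPairs (Separated H) M → AllPairs (Separated G) M
  all-separated []       []         = []
  all-separated (o ∷ os) (ss ∷ sss) = All.zipWith (λ (o′ , s) → separated-lift o o′ s) (os , ss) ∷ all-separated os sss

  -- A deleted vertex has no edges left, whereas every vertex of a copy has a neighbour.
  c52-outside : ∀ {f} → IsC52 H f → ∀ a → D (f a) ≡ false
  c52-outside (_ , iso) a with c52-neighbour a
  ... | b , e = proj₁ (proj₂ (delete⁻ G D (trans (iso a b) e)))

  c52-lift : ∀ {f} → IsC52 H f → IsC52 G f
  c52-lift C@(inj , iso) = inj , λ a b → trans (≡-sym (delete-outside G D (c52-outside C a) (c52-outside C b))) (iso a b)

  shrinks : suc (count (active H) (allFin n)) ≤ count (active G) (allFin n)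
  shrinks = unique-⊆⇒length≤ {xs = u ∷ filterᵇ (active H) (allFin n)}
    (All.tabulate (λ y∈ u≡y → clash (subst (λ z → active H z ≡ true) (≡-sym u≡y) (is-active y∈)) (delete-inactive G D Du))
      ∷ Uniqueₚ.filter⁺ (T? ∘ active H) (Uniqueₚ.allFin⁺ n))
    λ { (here refl) → ∈-filterᵇ⁺ (active G) (∈-allFin u) (active⁺ G uv)
      ; (there y∈)  → ∈-filterᵇ⁺ (active G) (∈-allFin _) (delete-active G D (is-active y∈)) }
    where
    is-active : ∀ {y} → y ∈ filterᵇ (active H) (allFin n) → active H y ≡ true
    is-active y∈ = proj₂ (∈-filterᵇ⁻ (active H) {xs = allFin n} y∈)

add-nine : ∀ {a b m} k → a ≤ b + 9 → b ≤ 9 * m + k → a ≤ 9 * suc m + k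
add-nine {a} {b} {m} k p q = ≤-trans p (≤-trans (ℕₚ.+-monoˡ-≤ 9 q) (≤-reflexive eq))
  where
  eq : 9 * m + k + 9 ≡ 9 * suc m + k
  eq = trans (ℕₚ.+-comm (9 * m + k) 9)
      (trans (≡-sym (ℕₚ.+-assoc 9 (9 * m) k)) (cong (_+ k) (≡-sym (ℕₚ.*-suc 9 m))))

module _ {n} {G : Graph n} where

  use-edge : ∀ {u v} → adj G u v ≡ true → crowd G u v ≤ 9 → Packing (delete G (near G u v)) → Packing G
  use-edge {u} {v} uv small P = record
    { matching  = (u , v) ∷ matching P
    ; copies    = copies P
    ; edges     = uv ∷ All.map proj₁ outs
    ; separated = All.map separated-first outs ∷ all-separated outs (separated P)
    ; are-C52   = All.map c52-lift (are-C52 P)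
    ; disjoint  = disjoint P
    ; covers    = add-nine (length (copies P)) bound (covers P)
    }
    where
    open Deletion G (near G u v) uv (λ _ e → e)
    outs : All Outside (matching P)
    outs = edges-outside (edges P)
    -- A vertex that is neither near the edge nor active afterwards must be stranded: any neighbour
    -- not near the edge would have kept it active.
    classify : ∀ x → active G x ≡ true → active H x ∨ (near G u v x ∨ stranded G u v x) ≡ true
    classify x act with dichotomy (active H x) | dichotomy (near G u v x)
    ... | inj₁ p | _      = ∨-trueˡ _ p
    ... | inj₂ p | inj₁ q = ∨-trueʳ (active H x) (∨-trueˡ _ q)
    ... | inj₂ p | inj₂ q = ∨-trueʳ (active H x) (∨-trueʳ (near G u v x)
                              (cong₂ _∧_ act (cong₂ _∧_ (cong not q) (all⁺ _ (allFin n) enclosed))))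
      where
      enclosed : ∀ z → not (adj G x z) ∨ near G u v z ≡ true
      enclosed z with dichotomy (adj G x z) | dichotomy (near G u v z)
      ... | inj₂ xz | _       = ∨-trueˡ _ (cong not xz)
      ... | inj₁ _  | inj₁ nz = ∨-trueʳ (not (adj G x z)) nz
      ... | inj₁ xz | inj₂ nz = clash (active⁺ H (trans (delete-outside G (near G u v) q nz) xz)) p
    bound : count (active G) (allFin n) ≤ count (active H) (allFin n) + 9
    bound = ≤-trans (count-mono classify (allFin n))
           (≤-trans (count-∨ (active H) _ (allFin n))
             (ℕₚ.+-monoʳ-≤ _ (≤-trans (count-∨ (near G u v) (stranded G u v) (allFin n)) small)))

  near⇒image : MaxDegreeAtMost G 4 → ∀ {f} → IsC52 G f → ∀ z → near G (f fz) (f (fs fz)) z ≡ true → image f z ≡ true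
  near⇒image Δ≤4 {f} C z e with ∨-true {adj G (f fz) z} e
  ... | inj₁ q = image⁺ {f = f} (c52-closed {G = G} Δ≤4 C fz z q)
  ... | inj₂ q = image⁺ {f = f} (c52-closed {G = G} Δ≤4 C (fs fz) z q)

  use-C52 : MaxDegreeAtMost G 4 → ∀ {f} → IsC52 G f → Packing (delete G (image f)) → Packing G
  use-C52 Δ≤4 {f} C@(inj , iso) P = record
    { matching  = (f fz , f (fs fz)) ∷ matching P
    ; copies    = f ∷ copies P
    ; edges     = iso fz (fs fz) ∷ All.map proj₁ outs
    ; separated = All.map separated-first outs ∷ all-separated outs (separated P)
    ; are-C52   = C ∷ All.map c52-lift (are-C52 P)
    ; disjoint  = All.map (λ C′ a b e → clash (image⁺ {f = f} (a , e)) (c52-outside C′ b)) (are-C52 P) ∷ disjoint P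
    ; covers    = ≤-trans bound (≤-reflexive (≡-sym (+-suc (9 * suc (length (matching P))) (length (copies P)))))
    }
    where
    open Deletion G (image f) (iso fz (fs fz)) (near⇒image Δ≤4 C)
    outs : All Outside (matching P)
    outs = edges-outside (edges P)
    -- Deleting a copy strands nothing, because no edge leaves it; the cost is just its ten
    -- vertices.
    survives : ∀ x → active G x ≡ true → active H x ∨ image f x ≡ true
    survives x act with dichotomy (image f x)
    ... | inj₁ q = ∨-trueʳ (active H x) q
    ... | inj₂ q with active⁻ G act
    ...   | z , xz = ∨-trueˡ _ (active⁺ H (trans (delete-outside G (image f) q (not-true inside)) xz))
      where
      inside : image f z ≢ true
      inside e with image⁻ {f = f} {z} e
      ... | a , refl = clash (image⁺ {f = f} (c52-closed {G = G} Δ≤4 C a x (trans (sym G (f a) x) xz))) q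
    count-image : count (image f) (allFin n) ≤ 10
    count-image = unique-⊆⇒length≤ {ys = map f (allFin 10)} (Uniqueₚ.filter⁺ (T? ∘ image f) (Uniqueₚ.allFin⁺ n))
      λ {z} z∈ → let a , e = image⁻ {f = f} {z} (proj₂ (∈-filterᵇ⁻ (image f) {xs = allFin n} z∈)) in
                 subst (_∈ map f (allFin 10)) e (∈-map⁺ f (∈-allFin a))
    bound : count (active G) (allFin n) ≤ suc (9 * suc (length (matching P)) + length (copies P))
    bound = ≤-trans (count-mono survives (allFin n))
           (≤-trans (count-∨ (active H) (image f) (allFin n))
           (≤-trans (ℕₚ.+-monoʳ-≤ (count (active H) (allFin n)) count-image)
           (≤-trans (≤-reflexive (+-suc (count (active H) (allFin n)) 9))
                    (s≤s (add-nine {b = count (active H) (allFin n)} (length (copies P)) ≤-refl (covers P))))))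

-- Induction on a bound `k` for the number of active vertices. Either reduction lowers that number,
-- since it makes the first end of the chosen edge inactive.
packing : ∀ {n} k (G : Graph n) → MaxDegreeAtMost G 4 → count (active G) (allFin n) ≤ k → Packing G
packing {n} k G Δ≤4 le with anyF? (λ x → active G x ≟B true)
... | no none = record
  { matching = [] ; copies = [] ; edges = [] ; separated = [] ; are-C52 = [] ; disjoint = []
  ; covers = unique-⊆⇒length≤ {ys = []} (Uniqueₚ.filter⁺ (T? ∘ active G) (Uniqueₚ.allFin⁺ n))
      λ {z} z∈ → contradiction (z , proj₂ (∈-filterᵇ⁻ (active G) {xs = allFin n} z∈)) none }
packing {n} zero G Δ≤4 le | yes (x , act) = contradiction le (<⇒≱ (unique-⊆⇒length≤ {xs = x ∷ []} ([] ∷ [])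
  λ { (here refl) → ∈-filterᵇ⁺ (active G) (∈-allFin x) act }))
packing {n} (suc k) G Δ≤4 le | yes (x , act) with good-edge-or-C52 G Δ≤4 act
... | inj₁ (f , C@(inj , iso)) = use-C52 Δ≤4 C (packing k (delete G (image f)) (delete-maxDegree G (image f) Δ≤4)
        (ℕₚ.≤-pred (≤-trans (Deletion.shrinks G (image f) (iso fz (fs fz)) (near⇒image {G = G} Δ≤4 C)) le)))
... | inj₂ (u , v , uv , small) = use-edge uv small (packing k (delete G (near G u v)) (delete-maxDegree G (near G u v) Δ≤4)
        (ℕₚ.≤-pred (≤-trans (Deletion.shrinks G (near G u v) uv (λ _ e → e)) le)))

-- Components, isolated vertices and the final count

module _ {n} {G : Graph n} where

  reach-trans : ∀ {x y z} → Reachable G x y → Reachable G y z → Reachable G x z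
  reach-trans here       q = q
  reach-trans (step e p) q = step e (reach-trans p q)

  reach-sym : ∀ {x y} → Reachable G x y → Reachable G y x
  reach-sym here                   = here
  reach-sym (step {x} {y} e p) = reach-trans (reach-sym p) (step (trans (sym G y x) e) here)

  -- Each copy is a whole component and so is reached from some entry of `R`. Two copies reached
  -- from the same entry would lie in one component and hence meet, so disjoint copies get distinct
  -- indices.
  copies≤reps : MaxDegreeAtMost G 4 → ∀ {R} → IsC52ComponentReps G R →
                ∀ {F} → All (IsC52 G) F → AllPairs Disjoint F → length F ≤ length R
  copies≤reps Δ≤4 {R} (_ , _ , complete) {F} Cs ds with represent Cs ds
    where
    represent : ∀ {F} → All (IsC52 G) F → AllPairs Disjoint F →
      ∃ λ is → length is ≡ length F × Unique is × (∀ {i} → i ∈ is → ∃ λ g → g ∈ F × Reachable G (lookup R i) (g fz))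
    represent []       []       = [] , refl , [] , λ ()
    represent {f ∷ F} (C ∷ Cs) (d ∷ ds) with represent Cs ds | complete (f fz) (c52-component Δ≤4 C)
    ... | is , len , u , reached | i , r = i ∷ is , cong suc len , All.tabulate new ∷ u ,
      λ { (here refl) → f , here refl , r ; (there j∈) → let g , g∈ , q = reached j∈ in g , there g∈ , q }
      where
      new : ∀ {j} → j ∈ is → i ≢ j
      new j∈ refl with reached j∈
      ... | g , g∈ , q with c52-reach-inside Δ≤4 C fz refl (reach-trans (reach-sym r) q)
      ...   | a , e = All.lookup d g∈ a fz e
  ... | is , len , u , _ = ≤-trans (≤-reflexive (≡-sym len)) (≤-trans
    (unique-⊆⇒length≤ u (λ {i} _ → ∈-allFin i)) (≤-reflexive (length-tabulate id)))

  Separated-sym : ∀ {e e′} → Separated G e e′ → Separated G e′ e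
  Separated-sym {a , b} {c , d} ((p , q , r , s) , (p′ , q′ , r′ , s′)) =
    (p ∘ ≡-sym , r ∘ ≡-sym , q ∘ ≡-sym , s ∘ ≡-sym) ,
    (trans (sym G c a) p′ , trans (sym G c b) r′ , trans (sym G d a) q′ , trans (sym G d b) s′)

  isolated-if-inactive : ∀ {x} → active G x ≡ false → degree G x ≡ 0
  isolated-if-inactive {x} e = cong length (filter-none (T? ∘ adj G x) {xs = allFin n}
    (All.tabulate (λ _ q → clash (active⁺ G (T⇒≡ q)) e)))

  active+isolated : n ≤ count (active G) (allFin n) + isolatedCount G
  active+isolated = ≤-trans (≤-reflexive (≡-sym (length-tabulate {n = n} id)))
    (length≤count+filter (active G) (λ x → degree G x ℕₚ.≟ 0) (λ x → isolated-if-inactive) (allFin n))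

allPairs-lookup : ∀ {A : Set} {R : A → A → Set} → (∀ {x y} → R x y → R y x) →
                  ∀ {xs} → AllPairs R xs → ∀ i j → i ≢ j → R (lookup xs i) (lookup xs j)
allPairs-lookup R-sym (r ∷ rs) fz     fz     i≢j = contradiction refl i≢j
allPairs-lookup R-sym {x ∷ xs} (r ∷ rs) fz     (fs j) _   = All.lookup r (∈-lookup {xs = xs} j)
allPairs-lookup R-sym {x ∷ xs} (r ∷ rs) (fs i) fz     _   = R-sym (All.lookup r (∈-lookup {xs = xs} i))
allPairs-lookup R-sym (r ∷ rs) (fs i) (fs j) i≢j = allPairs-lookup R-sym rs i j (i≢j ∘ cong fs)

theorem1 : ∀ (n : ℕ) (G : Graph n) → MaxDegreeAtMost G 4 →
    (R : List (Fin n)) → IsC52ComponentReps G R →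
    ∃ λ (M : List (Fin n × Fin n)) →
    IsInducedMatching G M × n ≤ 9 * length M + isolatedCount G + length R
theorem1 n G Δ≤4 R reps =
  matching P ,
  ((λ i → All.lookup (edges P) (∈-lookup i)) , allPairs-lookup (λ {e} {e′} → Separated-sym {G = G} {e} {e′}) (separated P)) ,
  total
  where
  P : Packing G
  P = packing _ G Δ≤4 ≤-refl
  total : n ≤ 9 * length (matching P) + isolatedCount G + length R
  total = begin
    n                                                              ≤⟨ active+isolated {G = G} ⟩
    count (active G) (allFin n) + i                                ≤⟨ ℕₚ.+-monoˡ-≤ i (covers P) ⟩
    9 * m + length (copies P) + i                                  ≡⟨ ℕₚ.+-assoc (9 * m) _ i ⟩
    9 * m + (length (copies P) + i)                                ≡⟨ cong (9 * m +_) (ℕₚ.+-comm _ i) ⟩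
    9 * m + (i + length (copies P))                                ≡⟨ ℕₚ.+-assoc (9 * m) i _ ⟨
    9 * m + i + length (copies P)                                  ≤⟨ ℕₚ.+-monoʳ-≤ (9 * m + i) (copies≤reps {G = G} Δ≤4 {R} reps (are-C52 P) (disjoint P)) ⟩
    9 * m + i + length R                                           ∎
    where
    open ℕₚ.≤-Reasoning
    m i : ℕ
    m = length (matching P)
    i = isolatedCount G
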